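{- For every positive integer $t$ there exists an integer $r(t)$ such that every ordered graph $(G,<)$ which does not contain the complete graph $K_t$ as an interval minor has rank at most $r(t)$.
   Context: An ordered graph $(G,<)$ is a finite simple graph $G$ together with a linear order $<$ on $V(G)$. An interval is a set of vertices consecutive in $<$. An ordered graph $(H,<')$ with vertices $u_1<'\dots<'u_h$ is an interval minor of $(G,<)$ if $V(G)$ can be partitioned into nonempty intervals $I_1<\dots<I_h$ (every vertex of $I_i$ precedes every vertex of $I_{i+1}$) such that whenever $u_iu_j\in E(H)$ there is an edge of $G$ with one endpoint in $I_i$ and the other in $I_j$ (equivalently, $(H,<')$ is obtained from $(G,<)$ by deleting edges and iteratively contracting pairs of vertices consecutive in the order). In particular $(G,<)$ contains $K_t$ as an interval minor iff $V(G)$ can be partitioned into $t$ nonempty intervals with an edge between any two of them. Operations on classes of ordered graphs. The substitution of a vertex $v$ of $(G,<)$ by an ordered graph $(H,<')$ replaces $v$ by a copy of $H$, keeps the edges of $H$, joins every neighbour of $v$ to every vertex of the copy, and places the vertices of the copy, ordered by $<'$, at the position of $v$ in $<$. The substitution closure $\overline{\mathcal C}$ of a class $\mathcal C$ is the class of ordered graphs obtained from a member of $\mathcal C$ by iterating any number (possibly zero) of substitutions of vertices by members of $\mathcal C$. The edge union $\mathcal C\oplus\mathcal C'$ is the class of ordered graphs $((V,E\cup E'),<)$ where $((V,E),<)\in\mathcal C$ and $((V,E'),<)\in\mathcal C'$ have the same vertex set and the same order. The independent concatenation $\mathcal C^+$ is the class of ordered graphs obtained from some $(G,<)\in\mathcal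 C$ by adding an independent set $I$ of new vertices either entirely before all vertices of $G$ or entirely after them in the order, with arbitrary edges between $I$ and $V(G)$. Rank: the empty graph has rank $0$. For $r\ge1$, the rank of $(G,<)$ is the smallest integer $r$ such that $(G,<)$ can be built from ordered graphs of rank at most $r-1$ by one of the operations above, i.e. $(G,<)$ lies in $\overline{\mathcal R_{r-1}}$, in $\mathcal R_{r-1}\oplus\mathcal R_{r-1}$, or in $\mathcal R_{r-1}^+$, where $\mathcal R_{r-1}$ is the class of ordered graphs of rank at most $r-1$. -}

module Defs where

open import Data.Nat using (ℕ; zero; suc; _+_)
import Data.Nat as ℕ
open import Data.Fin using (Fin; zero; suc; _↑ˡ_; _↑ʳ_; splitAt; cast; _≟_)
import Data.Fin as F
open import Data.Bool using (Bool; true; false; not; _∨_)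
open import Data.Sum using (_⊎_; inj₁; inj₂)
open import Data.Product using (Σ; ∃; _×_; _,_)
open import Data.Empty using (⊥-elim)
open import Relation.Nullary using (¬_; yes; no)
open import Relation.Nullary.Decidable using (⌊_⌋)
open import Relation.Binary.PropositionalEquality using (_≡_; refl; sym)

-- Ordered graphs on n vertices: vertex set Fin n, ordered by the natural
-- order of Fin n; adjacency is a symmetric irreflexive Bool matrix
-- (finite simple graph).

record Graph (n : ℕ) : Set where
  field
    adj    : Fin n → Fin n → Bool
    adj-sym    : ∀ i j → adj i j ≡ adj j i
    adj-irrefl : ∀ i → adj i i ≡ false
open Graph public

Class : Set₁
Class = ∀ {n} → Graph n → Set

complete : (t : ℕ) → Graph t
complete t = record { adj = λ i j → not ⌊ i ≟ j ⌋ ; adj-sym = s ; adj-irrefl = r }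
  where
  s : ∀ (i j : Fin t) → not ⌊ i ≟ j ⌋ ≡ not ⌊ j ≟ i ⌋
  s i j with i ≟ j | j ≟ i
  ... | yes _ | yes _ = refl
  ... | no _  | no _  = refl
  ... | yes p | no q  = ⊥-elim (q (sym p))
  ... | no p  | yes q = ⊥-elim (p (sym q))
  r : ∀ (i : Fin t) → not ⌊ i ≟ i ⌋ ≡ false
  r i with i ≟ i
  ... | yes _ = refl
  ... | no p  = ⊥-elim (p refl)

-- Interval minors.  A partition of V(G) = Fin n into nonempty intervals
-- I_1 < ... < I_h is the same as a weakly monotone surjection
-- f : Fin n → Fin h (I_a = f⁻¹(a)).

IntervalMinor : ∀ {h n} → Graph h → Graph n → Set
IntervalMinor {h} {n} H G =
  Σ (Fin n → Fin h) λ f →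
    (∀ x y → x F.≤ y → f x F.≤ f y) ×
    (∀ a → ∃ λ x → f x ≡ a) ×
    (∀ a b → adj H a b ≡ true →
       ∃ λ x → ∃ λ y → f x ≡ a × f y ≡ b × adj G x y ≡ true)

ContainsK : ∀ {n} → ℕ → Graph n → Set
ContainsK t G = IntervalMinor (complete t) G

-- Substitution of the vertex at position a of a graph on a + suc b
-- vertices by a graph on m vertices; the result has a + (m + b) vertices.

data Part (a m b : ℕ) : Set where
  inL : Fin a → Part a m b
  inM : Fin m → Part a m b
  inR : Fin b → Part a m b

part : ∀ a m b → Fin (a + (m + b)) → Part a m b
part a m b x with splitAt a x
... | inj₁ i = inL i
... | inj₂ y with splitAt m y
...   | inj₁ j = inM j
...   | inj₂ k = inR k

host : ∀ {a m b} → Part a m b → Fin (a + suc b)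
host {a} {m} {b} (inL i) = i ↑ˡ suc b
host {a} {m} {b} (inM _) = a ↑ʳ zero
host {a} {m} {b} (inR k) = a ↑ʳ suc k

substAdjP : ∀ {a m b} → Graph (a + suc b) → Graph m →
            Part a m b → Part a m b → Bool
substAdjP G H (inM i) (inM j) = adj H i j
substAdjP G H p q = adj G (host p) (host q)

substAdj : ∀ {a m b} → Graph (a + suc b) → Graph m →
           Fin (a + (m + b)) → Fin (a + (m + b)) → Bool
substAdj {a} {m} {b} G H x y = substAdjP G H (part a m b x) (part a m b y)

data SubstClosure (C : Class) : Class where
  base : ∀ {n} {G : Graph n} → C G → SubstClosure C G
  step : ∀ {a b m n'} (G : Graph (a + suc b)) (H : Graph (suc m))
           (G' : Graph n') (e : a + (suc m + b) ≡ n') →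
         SubstClosure C G → C H →
         (∀ x y → adj G' (cast e x) (cast e y) ≡ substAdj G H x y) →
         SubstClosure C G'

EdgeUnion : Class → Class → Class
EdgeUnion C C' {n} G =
  Σ (Graph n) λ G₁ → Σ (Graph n) λ G₂ → C G₁ × C' G₂ ×
    (∀ i j → adj G i j ≡ (adj G₁ i j ∨ adj G₂ i j))

data IndepConcat (C : Class) : Class where
  before : ∀ {n} {G' : Graph n} s k (G : Graph k) (e : s + k ≡ n) → C G →
           (∀ i j → adj G' (cast e (s ↑ʳ i)) (cast e (s ↑ʳ j)) ≡ adj G i j) →
           (∀ (i j : Fin s) → adj G' (cast e (i ↑ˡ k)) (cast e (j ↑ˡ k)) ≡ false) →
           IndepConcat C G'
  after  : ∀ {n} {G' : Graph n} s k (G : Graph k) (e : k + s ≡ n) → C G →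
           (∀ i j → adj G' (cast e (i ↑ˡ s)) (cast e (j ↑ˡ s)) ≡ adj G i j) →
           (∀ (i j : Fin s) → adj G' (cast e (k ↑ʳ i)) (cast e (k ↑ʳ j)) ≡ false) →
           IndepConcat C G'

-- Rank.  Level 0 = the empty graph; level (r+1) = graphs obtained from
-- level-r graphs by one of the three operations.  The rank of G is the
-- least r with G in level r; so "rank ≤ k" means: in some level r ≤ k.

Level : ℕ → Class
Level zero    {n} G = n ≡ 0
Level (suc r)     G = SubstClosure (Level r) G
                      ⊎ EdgeUnion (Level r) (Level r) G
                      ⊎ IndepConcat (Level r) G

RankAtMost : ∀ {n} → ℕ → Graph n → Set
RankAtMost k G = ∃ λ r → r ℕ.≤ k × Level r G

{-# OPTIONS --safe #-}
module Submission where

-- Fix a graph without a K_{t+1} minor, and recursively split an interval I of vertices into the vertices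
-- having a neighbour outside I (as singletons; the first vertex of I if there are none) and the maximal
-- runs of the others.  An edge is assigned to the smallest interval of this tree containing both ends; the
-- edges are then divided by the parity of its depth.
-- Every run has no neighbour outside its parent, so the edges assigned to I miss all runs among the
-- grandchildren of I: each of the two edge sets is obtained by substituting isolated vertices, starting
-- from the graphs formed by the edges assigned to a single interval I.
--
-- To bound the rank of such a graph, cut I after each singleton.  Each of the resulting pieces has a neighbour
-- to the left or to the right of I.  A K_t minor made of groups of pieces that all see the left side gives a
-- K_{t+1} minor by adding the left side as one more part, and likewise on the right; so after cutting once more,
-- at the pieces that see the left side, induction on t applies to all edges between pieces.  What remains
-- is handled by adding independent sets.
--
-- For the induction the statement is generalised: the vertices come in blocks, independent intervals, and only
-- minors whose parts are unions of blocks are excluded.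

open import Defs
open import Data.Bool using (Bool; true; false; not; _∧_; _∨_; if_then_else_)
open import Data.Bool.Properties using (∧-zeroʳ; ∧-identityʳ; ¬-not; not-involutive)
open import Data.Empty using (⊥-elim)
open import Data.Fin using (Fin; zero; suc; toℕ; fromℕ<; _↑ˡ_; _↑ʳ_; splitAt; cast)
open import Data.Fin.Properties using (cast-is-id; splitAt⁻¹-↑ˡ; splitAt⁻¹-↑ʳ)
open import Data.List using (List; []; _∷_; [_]; _++_; map; concat; concatMap; length; lookup; take; tabulate; allFin)
open import Data.List.Membership.Propositional using (_∈_; find; lose)
open import Data.List.Membership.Propositional.Properties using (∈-lookup; ∈-++⁺ˡ; ∈-++⁺ʳ; ∈-++⁻; ∈-map⁺; ∈-map⁻)
open import Data.List.Properties using (length-++; length-map; length-tabulate; ++-assoc; ++-identityʳ; map-++; concat-++; concatMap-++; concatMap-cong; concatMap-pure)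
open import Data.List.Relation.Binary.Sublist.Propositional using (_⊆_; []; _∷_; _∷ʳ_; minimum; ⊆-refl; ⊆-trans; ⊆-reflexive)
open import Data.List.Relation.Binary.Sublist.Propositional.Properties using (++⁺; ++⁺ˡ; ++⁺ʳ; All-resp-⊆; length-mono-≤)
open import Data.List.Relation.Unary.All as All using (All; []; _∷_)
open import Data.List.Relation.Unary.AllPairs as AllPairs using (AllPairs; []; _∷_)
open import Data.List.Relation.Unary.Any as Any using (Any; here; there)
open import Data.Nat using (ℕ; zero; suc; _+_; _≤_; z≤n; s≤s; s≤s⁻¹; _≤′_; ≤′-refl; ≤′-step; _≟_)
open import Data.Nat.Properties using (suc-injective; +-comm; ≤⇒≤′; ≤-trans; ≤-refl; n≤1+n; m≤n+m; m≤n⇒m≤1+n; <⇒≢; <⇒≤; <⇒≱; <-cmp)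
open import Data.Product using (∃; _×_; _,_; proj₁; proj₂)
open import Data.Sum using (_⊎_; inj₁; inj₂; [_,_]′)
open import Data.Unit using (⊤; tt)
open import Function using (_∘_; id)
open import Relation.Binary.Definitions using (tri<; tri≈; tri>)
open import Relation.Binary.PropositionalEquality using (_≡_; _≢_; refl; sym; trans; cong; cong₂; subst; module ≡-Reasoning)
open import Relation.Nullary using (¬_; yes; no)
open import Relation.Nullary.Decidable using (⌊_⌋)
import Data.Bool as Bool
import Data.Fin as F
import Data.Fin.Properties as Finₚ
import Data.List.Relation.Unary.All.Properties as Allₚ
import Data.List.Relation.Unary.AllPairs.Properties as AllPairsₚ
import Data.List.Relation.Unary.Any.Properties as Anyₚ

-- Levels and equality of adjacency

Extensional : Class → Set
Extensional C = ∀ {n} (G G′ : Graph n) → (∀ i j → adj G′ i j ≡ adj G i j) → C G → C G′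

SubstClosure-ext : {C : Class} → Extensional C → Extensional (SubstClosure C)
SubstClosure-ext C-ext G G′ eq (base c) = base (C-ext G G′ eq c)
SubstClosure-ext C-ext G G′ eq (step G₁ H _ e g h adj≡) =
  step G₁ H G′ e g h (λ x y → trans (eq _ _) (adj≡ x y))

-- Without function extensionality, graphs with the same adjacency need not be equal as records;
-- this lets each construction below be checked edge by edge.
Level-ext : ∀ r → Extensional (Level r)
Level-ext zero G G′ eq n≡0 = n≡0
Level-ext (suc r) G G′ eq (inj₁ s) = inj₁ (SubstClosure-ext (Level-ext r) G G′ eq s)
Level-ext (suc r) G G′ eq (inj₂ (inj₁ (G₁ , G₂ , l₁ , l₂ , adj≡))) =
  inj₂ (inj₁ (G₁ , G₂ , l₁ , l₂ , λ i j → trans (eq i j) (adj≡ i j)))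
Level-ext (suc r) G G′ eq (inj₂ (inj₂ (before s k G₁ e l adj≡ indep))) =
  inj₂ (inj₂ (before s k G₁ e l (λ i j → trans (eq _ _) (adj≡ i j)) (λ i j → trans (eq _ _) (indep i j))))
Level-ext (suc r) G G′ eq (inj₂ (inj₂ (after s k G₁ e l adj≡ indep))) =
  inj₂ (inj₂ (after s k G₁ e l (λ i j → trans (eq _ _) (adj≡ i j)) (λ i j → trans (eq _ _) (indep i j))))

Level-mono : ∀ {r s n} {G : Graph n} → r ≤ s → Level r G → Level s G
Level-mono {G = G} r≤s = go (≤⇒≤′ r≤s)
  where
  go : ∀ {r s} → r ≤′ s → Level r G → Level s G
  go ≤′-refl l = l
  -- Zero substitutions already lead to the next level.
  go (≤′-step r≤s) l = inj₁ (base (go r≤s l))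

cast-ext : {C : Class} → Extensional C → ∀ {m n} (G : Graph m) (G′ : Graph n) (m≡n : m ≡ n) →
           (∀ i j → adj G′ (cast m≡n i) (cast m≡n j) ≡ adj G i j) → C G → C G′
cast-ext C-ext G G′ refl eq = C-ext G G′ λ i j →
  trans (sym (cong₂ (adj G′) (cast-is-id refl i) (cast-is-id refl j))) (eq i j)

-- Ordered graphs as lists of labelled vertices

record SymRel (A : Set) : Set where
  field
    rel    : A → A → Bool
    symm   : ∀ x y → rel x y ≡ rel y x
    irrefl : ∀ x → rel x x ≡ false
open SymRel

private variable
  A A′ B B′ K X : Set
  q r t : ℕ

pullback : ∀ {n} → SymRel A → (Fin n → A) → Graph n
pullback e f = record
  { adj = λ i j → rel e (f i) (f j)
  ; adj-sym = λ i j → symm e (f i) (f j)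
  ; adj-irrefl = λ i → irrefl e (f i) }

induced : SymRel A → (xs : List A) → Graph (length xs)
induced e xs = pullback e (lookup xs)

-- A record rather than an abbreviation, so that unification can recover `e` and `xs`; the same goes
-- for `NoEdge`.
record InLevel (r : ℕ) (e : SymRel A) (xs : List A) : Set where
  constructor inLevel
  field
    level : Level r (induced e xs)
open InLevel

record NoEdge (e : SymRel A) (xs ys : List A) : Set where
  constructor noEdge
  field
    absent : ∀ {x y} → x ∈ xs → y ∈ ys → rel e x y ≡ false
open NoEdge

NoEdge-sym : {e : SymRel A} {xs ys : List A} → NoEdge e xs ys → NoEdge e ys xs
NoEdge-sym {e = e} ne = noEdge λ x∈ y∈ → trans (symm e _ _) (absent ne y∈ x∈)

NoEdge-⊆ : {e : SymRel A} {xs ys xs′ ys′ : List A} → (∀ {x} → x ∈ xs′ → x ∈ xs) → (∀ {y} → y ∈ ys′ → y ∈ ys) →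
           NoEdge e xs ys → NoEdge e xs′ ys′
NoEdge-⊆ xs⊆ ys⊆ ne = noEdge λ x∈ y∈ → absent ne (xs⊆ x∈) (ys⊆ y∈)

NoEdge-++ʳ : {e : SymRel A} {xs : List A} (ys : List A) {zs : List A} →
             NoEdge e xs ys → NoEdge e xs zs → NoEdge e xs (ys ++ zs)
NoEdge-++ʳ ys ne ne′ = noEdge λ x∈ y∈ → [ absent ne x∈ , absent ne′ x∈ ]′ (∈-++⁻ ys y∈)

InLevel-mono : {e : SymRel A} {xs : List A} → q ≤ r → InLevel q e xs → InLevel r e xs
InLevel-mono q≤r (inLevel l) = inLevel (Level-mono q≤r l)

lookup-map : (f : A → B) (xs : List A) .(eq : length xs ≡ length (map f xs)) (i : Fin (length xs)) →
             lookup (map f xs) (cast eq i) ≡ f (lookup xs i)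
lookup-map f (x ∷ xs) eq zero = refl
lookup-map f (x ∷ xs) eq (suc i) = lookup-map f xs (suc-injective eq) i

InLevel-map⁺ : ∀ {e : SymRel A} {e′ : SymRel B} (f : A → B) {xs} →
               (∀ {x y} → x ∈ xs → y ∈ xs → rel e′ (f x) (f y) ≡ rel e x y) →
               InLevel r e xs → InLevel r e′ (map f xs)
InLevel-map⁺ {r = r} {e′ = e′} f {xs} eq (inLevel l) = inLevel (cast-ext (Level-ext r) _ _ len (λ i j →
  trans (cong₂ (rel e′) (lookup-map f xs len i) (lookup-map f xs len j)) (eq (∈-lookup i) (∈-lookup j))) l)
  where
  len = sym (length-map f xs)

lookup-++ʳ : ∀ {m} (xs ys : List A) .(eq : length xs + m ≡ length (xs ++ ys)) .(eq′ : m ≡ length ys) (j : Fin m) →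
             lookup (xs ++ ys) (cast eq (length xs ↑ʳ j)) ≡ lookup ys (cast eq′ j)
lookup-++ʳ [] ys eq eq′ j = refl
lookup-++ʳ (x ∷ xs) ys eq eq′ j = lookup-++ʳ xs ys (suc-injective eq) eq′ j

lookup-++ˡ : ∀ {m} (xs ys : List A) .(eq : length xs + m ≡ length (xs ++ ys)) (i : Fin (length xs)) →
             lookup (xs ++ ys) (cast eq (i ↑ˡ m)) ≡ lookup xs i
lookup-++ˡ (x ∷ xs) ys eq zero = refl
lookup-++ˡ (x ∷ xs) ys eq (suc i) = lookup-++ˡ xs ys (suc-injective eq) i

-- This is independent concatenation, always on the right: the edges between `xs` and `ys` are
-- arbitrary.
append-independent : {e : SymRel A} {xs ys : List A} →
                     InLevel r e xs → NoEdge e ys ys → InLevel (suc r) e (xs ++ ys)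
append-independent {e = e} {xs} {ys} (inLevel l) ne =
  inLevel (inj₂ (inj₂ (after (length ys) (length xs) (induced e xs) len l
    (λ i j → cong₂ (rel e) (lookup-++ˡ xs ys len i) (lookup-++ˡ xs ys len j))
    (λ i j → trans (cong₂ (rel e) (inʳ i) (inʳ j)) (absent ne (∈-lookup i) (∈-lookup j))))))
  where
  len : length xs + length ys ≡ length (xs ++ ys)
  len = sym (length-++ xs)
  inʳ : ∀ j → lookup (xs ++ ys) (cast len (length xs ↑ʳ j)) ≡ lookup ys j
  inʳ j = trans (lookup-++ʳ xs ys len refl j) (cong (lookup ys) (cast-is-id refl j))

independent : {e : SymRel A} {xs : List A} → NoEdge e xs xs → InLevel 1 e xs
independent ne = append-independent {xs = []} (inLevel refl) ne

bipartite : {e : SymRel A} {xs ys : List A} → NoEdge e xs xs → NoEdge e ys ys → InLevel 2 e (xs ++ ys)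
bipartite nx ny = append-independent (independent nx) ny

-- Substitution of isolated vertices

-- As `v ∷ ms` has no edge to the rest, `v` is isolated in the host, and its copy gets no outside
-- neighbours from the substitution either.
substitute-isolated : (e : SymRel A) {ls rs ms : List A} {v : A} →
  SubstClosure (Level q) (induced e (ls ++ v ∷ rs)) → InLevel q e (v ∷ ms) →
  NoEdge e (v ∷ ms) (ls ++ rs) → SubstClosure (Level q) (induced e (ls ++ (v ∷ ms) ++ rs))
substitute-isolated {A = A} {q = q} e {ls} {rs} {ms} {v} outer (inLevel inner) iso =
  -- The host must have exactly `length ls + suc (length rs)` vertices, hence the pullback along
  -- `cast lenG`.
  step (pullback e (lookup (ls ++ v ∷ rs) ∘ cast lenG)) (induced e (v ∷ ms)) _ len
    (cast-ext (SubstClosure-ext (Level-ext q)) (induced e (ls ++ v ∷ rs)) _ (sym lenG)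
      (λ i j → cong₂ (rel e) (cong (lookup (ls ++ v ∷ rs)) (cast-cast lenG i))
                             (cong (lookup (ls ++ v ∷ rs)) (cast-cast lenG j))) outer)
    inner
    (λ x y → trans (cong₂ (rel e) (label-part x) (label-part y)) (adj-part (part _ _ _ x) (part _ _ _ y)))
  where
  cast-cast : ∀ {m n} (p : m ≡ n) (i : Fin n) → cast p (cast (sym p) i) ≡ i
  cast-cast refl i = trans (cast-is-id refl _) (cast-is-id refl i)
  lenG : length ls + suc (length rs) ≡ length (ls ++ v ∷ rs)
  lenG = sym (length-++ ls)
  lenM : suc (length ms) + length rs ≡ length ((v ∷ ms) ++ rs)
  lenM = sym (length-++ (v ∷ ms))
  len : length ls + (suc (length ms) + length rs) ≡ length (ls ++ (v ∷ ms) ++ rs)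
  len = trans (cong (length ls +_) lenM) (sym (length-++ ls))
  label : Part (length ls) (suc (length ms)) (length rs) → A
  label (inL i) = lookup ls i
  label (inM j) = lookup (v ∷ ms) j
  label (inR k) = lookup rs k
  at : ∀ {x y} → x ≡ y → lookup (ls ++ (v ∷ ms) ++ rs) (cast len x) ≡ lookup (ls ++ (v ∷ ms) ++ rs) (cast len y)
  at = cong (λ x → lookup (ls ++ (v ∷ ms) ++ rs) (cast len x))
  label-part : ∀ x → lookup (ls ++ (v ∷ ms) ++ rs) (cast len x) ≡ label (part _ _ _ x)
  label-part x with splitAt (length ls) x in eq
  ... | inj₁ i = trans (at (sym (splitAt⁻¹-↑ˡ eq))) (lookup-++ˡ ls _ len i)
  ... | inj₂ y with splitAt (suc (length ms)) y in eq′
  ...   | inj₁ j = trans (at (sym (trans (cong (length ls ↑ʳ_) (splitAt⁻¹-↑ˡ {i = y} eq′)) (splitAt⁻¹-↑ʳ {i = x} eq))))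
    (trans (lookup-++ʳ ls _ len lenM _) (lookup-++ˡ (v ∷ ms) rs lenM j))
  ...   | inj₂ k = trans (at (sym (trans (cong (length ls ↑ʳ_) (splitAt⁻¹-↑ʳ {i = y} eq′)) (splitAt⁻¹-↑ʳ {i = x} eq))))
    (trans (lookup-++ʳ ls _ len lenM _)
      (trans (lookup-++ʳ (v ∷ ms) rs lenM refl k) (cong (lookup rs) (cast-is-id refl k))))
  hostLabel : Part (length ls) (suc (length ms)) (length rs) → A
  hostLabel (inL i) = lookup ls i
  hostLabel (inM j) = v
  hostLabel (inR k) = lookup rs k
  hostLabel-host : ∀ p → lookup (ls ++ v ∷ rs) (cast lenG (host p)) ≡ hostLabel p
  hostLabel-host (inL i) = lookup-++ˡ ls (v ∷ rs) lenG i
  hostLabel-host (inM _) = lookup-++ʳ ls (v ∷ rs) lenG refl zero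
  hostLabel-host (inR k) = trans (lookup-++ʳ ls (v ∷ rs) lenG refl (suc k)) (cong (lookup rs) (cast-is-id refl k))
  via-host : ∀ p p′ → rel e (label p) (label p′) ≡ rel e (hostLabel p) (hostLabel p′) →
             rel e (label p) (label p′) ≡ rel e (lookup (ls ++ v ∷ rs) (cast lenG (host p))) (lookup (ls ++ v ∷ rs) (cast lenG (host p′)))
  via-host p p′ eq = trans eq (sym (cong₂ (rel e) (hostLabel-host p) (hostLabel-host p′)))
  twin : ∀ {x y} → x ∈ v ∷ ms → y ∈ ls ++ rs → rel e x y ≡ rel e v y
  twin x∈ y∈ = trans (absent iso x∈ y∈) (sym (absent iso (here refl) y∈))
  twin′ : ∀ {x y} → x ∈ v ∷ ms → y ∈ ls ++ rs → rel e y x ≡ rel e y v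
  twin′ x∈ y∈ = trans (symm e _ _) (trans (twin x∈ y∈) (symm e _ _))
  adj-part : ∀ p p′ → rel e (label p) (label p′) ≡ substAdjP (pullback e (lookup (ls ++ v ∷ rs) ∘ cast lenG)) (induced e (v ∷ ms)) p p′
  adj-part (inM _) (inM _) = refl
  adj-part p@(inL _) p′@(inL _) = via-host p p′ refl
  adj-part p@(inL _) p′@(inR _) = via-host p p′ refl
  adj-part p@(inR _) p′@(inL _) = via-host p p′ refl
  adj-part p@(inR _) p′@(inR _) = via-host p p′ refl
  adj-part p@(inL i) p′@(inM j) = via-host p p′ (twin′ (∈-lookup j) (∈-++⁺ˡ (∈-lookup {xs = ls} i)))
  adj-part p@(inM j) p′@(inL i) = via-host p p′ (twin (∈-lookup j) (∈-++⁺ˡ (∈-lookup {xs = ls} i)))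
  adj-part p@(inR i) p′@(inM j) = via-host p p′ (twin′ (∈-lookup j) (∈-++⁺ʳ ls (∈-lookup i)))
  adj-part p@(inM j) p′@(inR i) = via-host p p′ (twin (∈-lookup j) (∈-++⁺ʳ ls (∈-lookup i)))

-- The fragment of the substitution closure that the proof uses, phrased on lists: each copy is
-- isolated and begins with the vertex that it replaces.
data Closure (q : ℕ) (e : SymRel A) : List A → Set where
  base : ∀ {xs} → InLevel q e xs → Closure q e xs
  step : ∀ ls v ms rs → Closure q e (ls ++ v ∷ rs) → InLevel q e (v ∷ ms) →
         NoEdge e (v ∷ ms) (ls ++ rs) → Closure q e (ls ++ (v ∷ ms) ++ rs)

Closure⇒InLevel : {e : SymRel A} {xs : List A} → Closure q e xs → InLevel (suc q) e xs
Closure⇒InLevel {q = q} {e = e} = inLevel ∘ inj₁ ∘ go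
  where
  go : ∀ {xs} → Closure q e xs → SubstClosure (Level q) (induced e xs)
  go (base l) = base (level l)
  go (step ls v ms rs c l iso) = substitute-isolated e {ls = ls} (go c) l iso

Closure-map : {e : SymRel A} {e′ : SymRel B} (f : A → B) →
              (∀ x y → rel e′ (f x) (f y) ≡ rel e x y) →
              ∀ {xs} → Closure q e xs → Closure q e′ (map f xs)
Closure-map {q = q} {e = e} {e′} f eq = go
  where
  go : ∀ {xs} → Closure q e xs → Closure q e′ (map f xs)
  go (base l) = base (InLevel-map⁺ f (λ _ _ → eq _ _) l)
  go (step ls v ms rs c l iso) =
    subst (Closure q e′) (sym (trans (map-++ f ls _) (cong (map f ls ++_) (map-++ f (v ∷ ms) rs))))
      (step (map f ls) (f v) (map f ms) (map f rs)
        (subst (Closure q e′) (map-++ f ls _) (go c))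
        (InLevel-map⁺ f (λ _ _ → eq _ _) l)
        (noEdge λ x∈ y∈ → iso′ (∈-map⁻ f x∈) (∈-map⁻ f (subst (_ ∈_) (sym (map-++ f ls rs)) y∈))))
    where
    iso′ : ∀ {x y} → (∃ λ x₀ → x₀ ∈ v ∷ ms × x ≡ f x₀) → (∃ λ y₀ → y₀ ∈ ls ++ rs × y ≡ f y₀) → rel e′ x y ≡ false
    iso′ (_ , x∈ , refl) (_ , y∈ , refl) = trans (eq _ _) (absent iso x∈ y∈)

take1-⊆ : {x : A} {xs : List A} → x ∈ take 1 xs → x ∈ xs
take1-⊆ {xs = _ ∷ _} (here p) = here p

-- One substitution only inserts a graph of level `q`; here a whole member of the closure is
-- inserted for its first vertex, by replaying its derivation inside the larger list.
plug : {e : SymRel A} (ls rs : List A) {ms : List A} → Closure q e (ls ++ take 1 ms ++ rs) →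
       Closure q e ms → NoEdge e ms (ls ++ rs) → Closure q e (ls ++ ms ++ rs)
plug {q = q} {e = e} ls rs c (base l) iso = plug-base _ c l iso
  where
  plug-base : ∀ ms → Closure q e (ls ++ take 1 ms ++ rs) → InLevel q e ms → NoEdge e ms (ls ++ rs) →
              Closure q e (ls ++ ms ++ rs)
  plug-base [] c l iso = c
  plug-base (v ∷ ms) c l iso = step ls v ms rs c l iso
-- The list before its last substitution is plugged in first, and then `v` is replaced in place.
-- Since `v` heads its copy, both lists have the same first vertex.
plug {q = q} {e = e} ls rs c (step ls′ v ms rs′ d l iso′) iso =
  subst (Closure q e) (reassoc (v ∷ ms))
    (step (ls ++ ls′) v ms (rs′ ++ rs)
      (subst (Closure q e) (sym (reassoc [ v ]))
        (plug ls rs (subst (λ h → Closure q e (ls ++ h ++ rs)) (same-head ls′) c) d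
          (NoEdge-⊆ thin id iso)))
      l (NoEdge-++ʳ (ls ++ ls′)
          (NoEdge-++ʳ ls (NoEdge-⊆ mid ∈-++⁺ˡ iso) (NoEdge-⊆ id ∈-++⁺ˡ iso′))
          (NoEdge-++ʳ rs′ (NoEdge-⊆ id (∈-++⁺ʳ ls′) iso′) (NoEdge-⊆ mid (∈-++⁺ʳ ls) iso))))
  where
  reassoc : ∀ zs → (ls ++ ls′) ++ zs ++ rs′ ++ rs ≡ ls ++ (ls′ ++ zs ++ rs′) ++ rs
  reassoc zs = trans (++-assoc ls ls′ _) (cong (ls ++_)
    (trans (cong (ls′ ++_) (sym (++-assoc zs rs′ rs))) (sym (++-assoc ls′ (zs ++ rs′) rs))))
  same-head : ∀ zs → take 1 (zs ++ (v ∷ ms) ++ rs′) ≡ take 1 (zs ++ v ∷ rs′)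
  same-head [] = refl
  same-head (z ∷ zs) = refl
  mid : ∀ {x} → x ∈ v ∷ ms → x ∈ ls′ ++ (v ∷ ms) ++ rs′
  mid x∈ = ∈-++⁺ʳ ls′ (∈-++⁺ˡ x∈)
  thin : ∀ {x} → x ∈ ls′ ++ v ∷ rs′ → x ∈ ls′ ++ (v ∷ ms) ++ rs′
  thin x∈ with ∈-++⁻ ls′ x∈
  ... | inj₁ x∈ls′ = ∈-++⁺ˡ x∈ls′
  ... | inj₂ (here refl) = ∈-++⁺ʳ ls′ (here refl)
  ... | inj₂ (there x∈rs′) = ∈-++⁺ʳ ls′ (∈-++⁺ʳ (v ∷ ms) x∈rs′)

-- An item flagged true stands for an interval that gets contracted to its first vertex.
Item : Set → Set
Item A = List A × Bool

rep : Item A → List A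
rep (xs , true) = take 1 xs
rep (xs , false) = xs

rep-⊆ : (s : Item A) {x : A} → x ∈ rep s → x ∈ proj₁ s
rep-⊆ (xs , true) = take1-⊆
rep-⊆ (xs , false) = id

-- Edges between two unflagged items are left free: contraction does not touch them.
Separated : SymRel A → Item A → Item A → Set
Separated e s t = proj₂ s ≡ true ⊎ proj₂ t ≡ true → NoEdge e (proj₁ s) (proj₁ t)

∈-reps : ∀ {x : A} ss → x ∈ concatMap rep ss → ∃ λ s → s ∈ ss × x ∈ rep s
∈-reps (s ∷ ss) x∈ with ∈-++⁻ (rep s) x∈
... | inj₁ x∈s = s , here refl , x∈s
... | inj₂ x∈ss = let s′ , s′∈ , x∈s′ = ∈-reps ss x∈ss in s′ , there s′∈ , x∈s′

-- The items are restored from left to right by `plug`; `pre` is the part already expanded, so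
-- isolation from it has to be carried along.
expand : (e : SymRel A) (pre : List A) {ss : List (Item A)} →
         All (λ s → proj₂ s ≡ true → Closure q e (proj₁ s) × NoEdge e (proj₁ s) pre) ss →
         AllPairs (Separated e) ss →
         Closure q e (pre ++ concatMap rep ss) → Closure q e (pre ++ concatMap proj₁ ss)
expand e pre [] [] c = c
expand {q = q} e pre {(xs , b) ∷ ss} (p ∷ ps) (sep ∷ seps) c =
  subst (Closure q e) (++-assoc pre xs _)
    (expand e (pre ++ xs) ps′ seps (subst (Closure q e) (sym (++-assoc pre xs _)) (first b p sep c)))
  where
  first : ∀ b → (b ≡ true → Closure q e xs × NoEdge e xs pre) → All (Separated e (xs , b)) ss →
          Closure q e (pre ++ rep (xs , b) ++ concatMap rep ss) → Closure q e (pre ++ xs ++ concatMap rep ss)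
  first false p sep c = c
  first true p sep c = plug pre (concatMap rep ss) c (proj₁ (p refl))
    (NoEdge-++ʳ pre (proj₂ (p refl)) (noEdge λ x∈ y∈ss →
      let s , s∈ , y∈s = ∈-reps ss y∈ss in absent (All.lookup sep s∈ (inj₁ refl)) x∈ (rep-⊆ s y∈s)))
  ps′ : All (λ s → proj₂ s ≡ true → Closure q e (proj₁ s) × NoEdge e (proj₁ s) (pre ++ xs)) ss
  ps′ = All.zipWith extend (ps , sep)
    where
    extend : ∀ {s} → (proj₂ s ≡ true → Closure q e (proj₁ s) × NoEdge e (proj₁ s) pre) × Separated e (xs , b) s →
             proj₂ s ≡ true → Closure q e (proj₁ s) × NoEdge e (proj₁ s) (pre ++ xs)
    extend (p , sep) flagged = proj₁ (p flagged) ,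
      NoEdge-++ʳ pre (proj₂ (p flagged)) (NoEdge-sym (sep (inj₂ flagged)))

Apart : SymRel A → Item A → Item A → Set
Apart e s t = NoEdge e (proj₁ s) (proj₁ t)

reps-independent : {e : SymRel A} {ss : List (Item A)} →
                   All (λ s → proj₂ s ≡ false → Apart e s s) ss → AllPairs (Apart e) ss →
                   NoEdge e (concatMap rep ss) (concatMap rep ss)
reps-independent [] [] = noEdge λ ()
reps-independent {e = e} {s ∷ ss} (p ∷ ps) (ap ∷ aps) =
  NoEdge-++ʳ (rep s)
    (NoEdge-sym (NoEdge-++ʳ (rep s) (within s p) rest))
    (NoEdge-sym (NoEdge-++ʳ (rep s) (NoEdge-sym rest) (reps-independent ps aps)))
  where
  within : ∀ s → (proj₂ s ≡ false → Apart e s s) → NoEdge e (rep s) (rep s)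
  within (x ∷ xs , true) p = noEdge λ { (here refl) (here refl) → irrefl e x }
  within ([] , true) p = noEdge λ ()
  within (xs , false) p = p refl
  rest : NoEdge e (rep s) (concatMap rep ss)
  rest = noEdge λ x∈ y∈ → let t , t∈ , y∈t = ∈-reps ss y∈ in absent (All.lookup ap t∈) (rep-⊆ s x∈) (rep-⊆ t y∈t)

-- Contracting the flagged items leaves an independent set, which has level 1; `expand` then
-- restores them.
disjoint-union : {e : SymRel A} → 1 ≤ q → {ss : List (Item A)} →
                 All (λ s → proj₂ s ≡ true → Closure q e (proj₁ s)) ss →
                 All (λ s → proj₂ s ≡ false → Apart e s s) ss → AllPairs (Apart e) ss →
                 Closure q e (concatMap proj₁ ss)
disjoint-union {e = e} 1≤q cs ps aps =
  expand e [] (All.map (λ c flagged → c flagged , noEdge λ _ ()) cs) (AllPairs.map (λ ap _ → ap) aps)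
    (base (InLevel-mono 1≤q (independent (reps-independent ps aps))))

-- Splitting edge sets

record Mask (K : Set) : Set where
  field
    mask     : K → K → Bool
    mask-sym : ∀ k l → mask k l ≡ mask l k
open Mask

∁ : Mask K → Mask K
∁ m = record { mask = λ k l → not (mask m k l) ; mask-sym = λ k l → cong not (mask-sym m k l) }

_↾_ : SymRel A → Mask K → SymRel (A × K)
e ↾ m = record
  { rel = λ (x , k) (y , l) → rel e x y ∧ mask m k l
  ; symm = λ (x , k) (y , l) → cong₂ _∧_ (symm e x y) (mask-sym m k l)
  ; irrefl = λ (x , k) → cong (_∧ mask m k k) (irrefl e x) }

↾-off : (e : SymRel A) (m : Mask K) {x y : A × K} → mask m (proj₂ x) (proj₂ y) ≡ false → rel (e ↾ m) x y ≡ false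
↾-off e m off rewrite off = ∧-zeroʳ _

↾-on : (e : SymRel A) (m : Mask K) {x y : A × K} → mask m (proj₂ x) (proj₂ y) ≡ true →
       rel (e ↾ m) x y ≡ rel e (proj₁ x) (proj₁ y)
↾-on e m on rewrite on = ∧-identityʳ _

↾-false : (e : SymRel A) (m : Mask K) {x y : A × K} → rel e (proj₁ x) (proj₁ y) ≡ false → rel (e ↾ m) x y ≡ false
↾-false e m no-edge rewrite no-edge = refl

↾-true : (e : SymRel A) (m : Mask K) {x y : A × K} → rel (e ↾ m) x y ≡ true → rel e (proj₁ x) (proj₁ y) ≡ true
↾-true e m {x} {y} edge with rel e (proj₁ x) (proj₁ y)
... | true = refl

edge-union : {e : SymRel A} (m : Mask K) {xs : List (A × K)} →
             InLevel q (e ↾ m) xs → InLevel q (e ↾ ∁ m) xs → InLevel (suc q) e (map proj₁ xs)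
edge-union {A = A} {K = K} {e = e} m {xs} (inLevel l) (inLevel l′) =
  InLevel-map⁺ proj₁ (λ _ _ → refl) (inLevel {e = unlabelled} (inj₂ (inj₁
    (_ , _ , l , l′ , λ i j → or-split _ (mask m (proj₂ (lookup xs i)) (proj₂ (lookup xs j)))))))
  where
  unlabelled : SymRel (A × K)
  unlabelled = record
    { rel = λ x y → rel e (proj₁ x) (proj₁ y) ; symm = λ x y → symm e _ _ ; irrefl = λ x → irrefl e _ }
  or-split : ∀ b c → b ≡ ((b ∧ c) ∨ (b ∧ not c))
  or-split false _ = refl
  or-split true true = refl
  or-split true false = refl

same : Mask ℕ
same = record { mask = λ i j → ⌊ i ≟ j ⌋ ; mask-sym = same-sym }
  where
  same-sym : ∀ i j → ⌊ i ≟ j ⌋ ≡ ⌊ j ≟ i ⌋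
  same-sym i j with i ≟ j | j ≟ i
  ... | yes _ | yes _ = refl
  ... | no _ | no _ = refl
  ... | yes refl | no j≢i = ⊥-elim (j≢i refl)
  ... | no i≢j | yes refl = ⊥-elim (i≢j refl)

same-refl : ∀ i → mask same i i ≡ true
same-refl i with i ≟ i
... | yes _ = refl
... | no i≢i = ⊥-elim (i≢i refl)

same-≢ : ∀ {i j} → i ≢ j → mask same i j ≡ false
same-≢ {i} {j} i≢j with i ≟ j
... | yes i≡j = ⊥-elim (i≢j i≡j)
... | no _ = refl

number : ℕ → List X → List (X × ℕ)
number i [] = []
number i (x ∷ xs) = (x , i) ∷ number (suc i) xs

labelled : (X → List A) → X × ℕ → List (A × ℕ)
labelled g (x , i) = map (_, i) (g x)

cross : SymRel A → SymRel (A × ℕ)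
cross e = e ↾ ∁ same

labelled-independent : {e : SymRel A} (g : X → List A) (p : X × ℕ) → NoEdge (cross e) (labelled g p) (labelled g p)
labelled-independent {e = e} g (x , i) = noEdge λ u∈ v∈ → go (∈-map⁻ _ u∈) (∈-map⁻ _ v∈)
  where
  go : ∀ {u v} → (∃ λ a → a ∈ g x × u ≡ (a , i)) → (∃ λ b → b ∈ g x × v ≡ (b , i)) → rel (cross e) u v ≡ false
  go (_ , _ , refl) (_ , _ , refl) = ↾-off e (∁ same) (cong not (same-refl i))

-- The edges inside parts form a disjoint union of the graphs `g p`, one level above `q`; the edge
-- union with the cross edges costs one more level.
split-edges : {e : SymRel A} → 1 ≤ q → (g : X → List A) {ps : List X} → All (λ p → InLevel q e (g p)) ps →
              InLevel q (cross e) (concatMap (labelled g) (number 0 ps)) → InLevel (2 + q) e (concatMap g ps)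
split-edges {A = A} {q = q} {X = X} {e = e} 1≤q g {ps} ls c =
  subst (InLevel _ e) (unlabel 0 ps)
    (edge-union same
      (subst (InLevel _ _) (bodies 0 ps)
        (Closure⇒InLevel (disjoint-union 1≤q (closures 0 ls) (flagged 0 ps) (apart 0 ps))))
      (InLevel-mono (n≤1+n q) c))
  where
  items : ℕ → List X → List (Item (A × ℕ))
  items i [] = []
  items i (p ∷ ps) = (labelled g (p , i) , true) ∷ items (suc i) ps
  bodies : ∀ i ps → concatMap proj₁ (items i ps) ≡ concatMap (labelled g) (number i ps)
  bodies i [] = refl
  bodies i (p ∷ ps) = cong (labelled g (p , i) ++_) (bodies (suc i) ps)
  unlabel : ∀ i ps → map proj₁ (concatMap (labelled g) (number i ps)) ≡ concatMap g ps
  unlabel i [] = refl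
  unlabel i (p ∷ ps) = trans (map-++ proj₁ (labelled g (p , i)) _) (cong₂ _++_ (unmap (g p)) (unlabel (suc i) ps))
    where
    unmap : ∀ (xs : List A) → map proj₁ (map (_, i) xs) ≡ xs
    unmap [] = refl
    unmap (x ∷ xs) = cong (x ∷_) (unmap xs)
  closures : ∀ i {ps} → All (λ p → InLevel q e (g p)) ps →
             All (λ s → proj₂ s ≡ true → Closure q (e ↾ same) (proj₁ s)) (items i ps)
  closures i [] = []
  closures i (l ∷ ls) = (λ _ → base (InLevel-map⁺ (_, i) (λ _ _ → ↾-on e same (same-refl i)) l)) ∷ closures (suc i) ls
  flagged : ∀ i ps → All (λ s → proj₂ s ≡ false → Apart (e ↾ same) s s) (items i ps)
  flagged i [] = []
  flagged i (p ∷ ps) = (λ ()) ∷ flagged (suc i) ps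
  bound : ∀ i ps → All (λ s → All (λ x → i ≤ proj₂ x) (proj₁ s)) (items i ps)
  bound i [] = []
  bound i (p ∷ ps) = Allₚ.map⁺ (All.universal (λ _ → ≤-refl) (g p)) ∷ All.map (All.map (≤-trans (n≤1+n i))) (bound (suc i) ps)
  apart : ∀ i ps → AllPairs (Apart (e ↾ same)) (items i ps)
  apart i [] = []
  apart i (p ∷ ps) = All.map (λ b → noEdge λ x∈ y∈ → off (∈-map⁻ _ x∈) (All.lookup b y∈)) (bound (suc i) ps) ∷ apart (suc i) ps
    where
    off : ∀ {x y} → (∃ λ a → a ∈ g p × x ≡ (a , i)) → suc i ≤ proj₂ y → rel (e ↾ same) x y ≡ false
    off (_ , _ , refl) i<j = ↾-off e same (same-≢ (<⇒≢ i<j))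

-- With only two parts the cross edges form a bipartite graph, which has level 2.
join : {e : SymRel A} → 2 ≤ q → {xs ys : List A} → InLevel q e xs → InLevel q e ys → InLevel (2 + q) e (xs ++ ys)
join {e = e} 2≤q {xs} {ys} lx ly =
  subst (InLevel _ e) (cong (xs ++_) (++-identityʳ ys))
    (split-edges (≤-trans (n≤1+n 1) 2≤q) id {xs ∷ ys ∷ []} (lx ∷ ly ∷ [])
      (InLevel-mono 2≤q (subst (λ zs → InLevel 2 (cross e) (labelled id (xs , 0) ++ zs)) (sym (++-identityʳ _))
        (bipartite (labelled-independent id (xs , 0)) (labelled-independent id (ys , 1))))))

-- The list is s₁ m₁ s₂ m₂ … tl, with independent mᵢ.
chopped : {e : SymRel A} → 1 ≤ q → (s m : X → List A) {ps : List X} {tl : List A} →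
          All (λ p → InLevel q e (s p)) ps → (∀ p → NoEdge e (m p) (m p)) → InLevel q e tl →
          InLevel q (cross e) (concatMap (labelled (λ p → s p ++ m p)) (number 0 ps)) →
          InLevel (5 + q) e (concatMap (λ p → s p ++ m p) ps ++ tl)
-- The 5 is 1 for appending each independent set, 2 for `split-edges` and 2 for joining the tail.
chopped {q = q} 1≤q s m ls ms lt c =
  join (s≤s (s≤s z≤n))
    (split-edges (s≤s z≤n) _ (All.map (λ l → append-independent l (ms _)) ls) (InLevel-mono (n≤1+n q) c))
    (InLevel-mono (m≤n+m q 3) lt)

-- Clique minors

Linked : SymRel A → (B → List A) → List B → List B → Set
Linked e fib bs cs = ∃ λ x → ∃ λ y → x ∈ concatMap fib bs × y ∈ concatMap fib cs × rel e x y ≡ true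

-- A K_t interval minor whose intervals are unions of blocks, each containing a marked block.
-- The parts need not cover bs: blocks in between can be added to neighbouring parts.
record Minor (Marked : B → Set) (t : ℕ) (e : SymRel A) (fib : B → List A) (bs : List B) : Set where
  field
    parts  : List (List B)
    count  : length parts ≡ t
    within : concat parts ⊆ bs
    marked : All (Any Marked) parts
    linked : AllPairs (Linked e fib) parts
open Minor

Anything : B → Set
Anything _ = ⊤

-- Vertex and block types vary because the induction hypothesis is applied to `cross` graphs whose
-- blocks are whole pieces; these are independent there, as `cross` drops the edges inside a piece.
BoundedRank : ℕ → ℕ → Set₁
BoundedRank t r = ∀ {A B : Set} (e : SymRel A) (fib : B → List A) (bs : List B) →
  (∀ b → NoEdge e (fib b) (fib b)) → ¬ Minor Anything t e fib bs → InLevel r e (concatMap fib bs)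

concatMap-⊆ : (f : A → List B) {xs ys : List A} → xs ⊆ ys → concatMap f xs ⊆ concatMap f ys
concatMap-⊆ f [] = []
concatMap-⊆ f (y ∷ʳ p) = ++⁺ˡ (f y) (concatMap-⊆ f p)
concatMap-⊆ f (_∷_ {x} refl p) = ++⁺ (⊆-refl {x = f x}) (concatMap-⊆ f p)

concat-concatMap : (f : A → List B) (xss : List (List A)) → concat (map (concatMap f) xss) ≡ concatMap f (concat xss)
concat-concatMap f [] = refl
concat-concatMap f (xs ∷ xss) = trans (cong (concatMap f xs ++_) (concat-concatMap f xss)) (sym (concatMap-++ f xs (concat xss)))

∈-flat⁻ : (fib : B → List A) {x : A} (bs : List B) → x ∈ concatMap fib bs → ∃ λ b → b ∈ bs × x ∈ fib b
∈-flat⁻ fib (b ∷ bs) x∈ with ∈-++⁻ (fib b) x∈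
... | inj₁ x∈b = b , here refl , x∈b
... | inj₂ x∈bs = let b′ , b′∈ , x∈b′ = ∈-flat⁻ fib bs x∈bs in b′ , there b′∈ , x∈b′

∈-flat⁺ : (fib : B → List A) {x : A} {b : B} {bs : List B} → b ∈ bs → x ∈ fib b → x ∈ concatMap fib bs
∈-flat⁺ fib (here refl) x∈ = ∈-++⁺ˡ x∈
∈-flat⁺ fib {bs = b ∷ bs} (there b∈) x∈ = ∈-++⁺ʳ (fib b) (∈-flat⁺ fib b∈ x∈)

flat-⊆ : (fib : B → List A) (bs cs : List B) → (∀ {b} → b ∈ bs → b ∈ cs) → ∀ {x} → x ∈ concatMap fib bs → x ∈ concatMap fib cs
flat-⊆ fib bs cs bs⊆ x∈ = let _ , b∈ , x∈b = ∈-flat⁻ fib bs x∈ in ∈-flat⁺ fib (bs⊆ b∈) x∈b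

-- Pulls a minor of a coarser or labelled graph back to the original one: `φ` blows a block up into
-- the original blocks it stands for, and `u` forgets labels.
Minor-map : {e : SymRel A} {e′ : SymRel A′} {fib : B → List A} {fib′ : B′ → List A′} {M : B → Set} {M′ : B′ → Set}
            (φ : B′ → List B) (u : A′ → A) → (∀ {x y} → rel e′ x y ≡ true → rel e (u x) (u y) ≡ true) →
            (∀ b {x} → x ∈ fib′ b → u x ∈ concatMap fib (φ b)) → (∀ {b} → M′ b → Any M (φ b)) →
            {bs : List B} {bs′ : List B′} → concatMap φ bs′ ⊆ bs → Minor M′ t e′ fib′ bs′ → Minor M t e fib bs
Minor-map {e = e} {e′} {fib} {fib′} {M} {M′} φ u edge sub mark bs′⊆bs K = record
  { parts = map (concatMap φ) (parts K)
  ; count = trans (length-map _ (parts K)) (count K)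
  ; within = ⊆-trans (⊆-reflexive (concat-concatMap φ (parts K))) (⊆-trans (concatMap-⊆ φ (within K)) bs′⊆bs)
  ; marked = go (marked K)
  ; linked = AllPairsₚ.map⁺ (AllPairs.map (λ {ys} {zs} → link ys zs) (linked K))
  }
  where
  any : ∀ {ys} → Any M′ ys → Any M (concatMap φ ys)
  any (here {x = b} m) = Anyₚ.++⁺ˡ (mark m)
  any (there {x = b} m) = Anyₚ.++⁺ʳ (φ b) (any m)
  go : ∀ {yss} → All (Any M′) yss → All (Any M) (map (concatMap φ) yss)
  go [] = []
  go (m ∷ ms) = any m ∷ go ms
  below : ∀ ys {x} → x ∈ concatMap fib′ ys → u x ∈ concatMap fib (concatMap φ ys)
  below ys x∈ = let b , b∈ , x∈b = ∈-flat⁻ fib′ ys x∈ in flat-⊆ fib (φ b) (concatMap φ ys) (∈-flat⁺ φ b∈) (sub b x∈b)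
  link : ∀ ys zs → Linked e′ fib′ ys zs → Linked e fib (concatMap φ ys) (concatMap φ zs)
  link ys zs (x , y , x∈ , y∈ , xy) = u x , u y , below ys x∈ , below zs y∈ , edge xy

Minor-⊆ : {e : SymRel A} {fib : B → List A} {M : B → Set} {bs cs : List B} → bs ⊆ cs → Minor M t e fib bs → Minor M t e fib cs
Minor-⊆ bs⊆cs K = record
  { parts = parts K ; count = count K ; within = ⊆-trans (within K) bs⊆cs ; marked = marked K ; linked = linked K }

-- A part marked by `Anything` is nonempty, so its first block can serve as the mark.
Minor-mark : {e : SymRel A} {fib : B → List A} {M : B → Set} {bs : List B} → All M bs →
             Minor Anything t e fib bs → Minor M t e fib bs
Minor-mark {M = M} ms K = record
  { parts = parts K ; count = count K ; within = within K ; linked = linked K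
  ; marked = go (parts K) (All-resp-⊆ (within K) ms) (marked K) }
  where
  go : ∀ yss → All M (concat yss) → All (Any Anything) yss → All (Any M) yss
  go [] _ [] = []
  go ((y ∷ ys) ∷ yss) (m ∷ ms) (_ ∷ as) = here m ∷ go yss (Allₚ.++⁻ʳ ys ms) as

-- Cutting a sequence of blocks at marked blocks

record Piece (P M : B → Set) : Set where
  field
    run   : List B
    run-P : All P run
    cut   : B
    cut-M : M cut
open Piece

body : {P M : B → Set} → Piece P M → List B
body p = run p ++ [ cut p ]

record Chop (P M : B → Set) (bs : List B) : Set where
  field
    pieces : List (Piece P M)
    rest   : List B
    rest-P : All P rest
    covers : concatMap body pieces ++ rest ≡ bs
open Chop

chop : {P M : B → Set} {bs : List B} → All (λ b → P b ⊎ M b) bs → Chop P M bs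
chop [] = record { pieces = [] ; rest = [] ; rest-P = [] ; covers = refl }
chop {bs = b ∷ _} (inj₂ m ∷ ds) = let c = chop ds in record
  { pieces = record { run = [] ; run-P = [] ; cut = b ; cut-M = m } ∷ pieces c
  ; rest = rest c ; rest-P = rest-P c ; covers = cong (b ∷_) (covers c) }
chop {P = P} {M} {bs = b ∷ _} (inj₁ p ∷ ds) = extend (chop ds)
  where
  extend : ∀ {bs} → Chop P M bs → Chop P M (b ∷ bs)
  extend record { pieces = [] ; rest = rs ; rest-P = ps ; covers = eq } =
    record { pieces = [] ; rest = b ∷ rs ; rest-P = p ∷ ps ; covers = cong (b ∷_) eq }
  extend record { pieces = x ∷ xs ; rest = rs ; rest-P = ps ; covers = eq } = record
    { pieces = record { run = b ∷ run x ; run-P = p ∷ run-P x ; cut = cut x ; cut-M = cut-M x } ∷ xs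
    ; rest = rs ; rest-P = ps ; covers = cong (b ∷_) eq }

concatMap-∘ : (g : B → List A) (f : X → List B) (xs : List X) → concatMap (concatMap g ∘ f) xs ≡ concatMap g (concatMap f xs)
concatMap-∘ g f [] = refl
concatMap-∘ g f (x ∷ xs) = trans (cong (concatMap g (f x) ++_) (concatMap-∘ g f xs)) (sym (concatMap-++ g (f x) (concatMap f xs)))

unnumber : (f : X → List B) (i : ℕ) (xs : List X) → concatMap (f ∘ proj₁) (number i xs) ≡ concatMap f xs
unnumber f i [] = refl
unnumber f i (x ∷ xs) = cong (f x ++_) (unnumber f (suc i) xs)

-- The sequence is cut after blocks with mark `M`. The runs in between consist of `N`-blocks only,
-- so a K_t minor inside one would be `N`-marked; every piece ends in an `M`-block, so a K_t minor
-- of the cross edges, built from whole pieces, would be `M`-marked.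
doubly-marked : {e : SymRel A} {fib : B → List A} {M N : B → Set} {bs : List B} → BoundedRank t r →
                (∀ b → NoEdge e (fib b) (fib b)) → (∀ b → N b ⊎ M b) →
                ¬ Minor M t e fib bs → ¬ Minor N t e fib bs → InLevel (6 + r) e (concatMap fib bs)
doubly-marked {A = A} {B = B} {t = t} {r = r} {e} {fib} {M} {N} {bs} bounded indep N⊎M ¬KM ¬KN =
  subst (InLevel _ e) flat-covers
    -- `chopped` is used at level `suc r`, which is positive even for `r` zero; this gives 5 + 1 +
    -- r.
    (chopped (s≤s z≤n) (concatMap fib ∘ run) (concatMap fib ∘ [_] ∘ cut)
      (runs (pieces c) (⊆-trans (++⁺ʳ (rest c) ⊆-refl) (⊆-reflexive (covers c))))
      (λ p → NoEdge-⊆ single single (indep (cut p)))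
      (InLevel-mono (n≤1+n r) (bounded e fib (rest c) indep λ K →
        ¬KN (Minor-⊆ (⊆-trans (++⁺ˡ (concatMap body (pieces c)) ⊆-refl) (⊆-reflexive (covers c))) (Minor-mark (rest-P c) K))))
      (InLevel-mono (n≤1+n r) (bounded (cross e) _ (number 0 (pieces c)) (labelled-independent _) λ K →
        ¬KM (Minor-map (body ∘ proj₁) proj₁ (↾-true e (∁ same)) below (λ {p} _ → Anyₚ.++⁺ʳ (run (proj₁ p)) (here (cut-M (proj₁ p))))
          (⊆-trans (⊆-reflexive (unnumber body 0 (pieces c))) (⊆-trans (++⁺ʳ (rest c) ⊆-refl) (⊆-reflexive (covers c)))) K))))
  where
  c : Chop N M bs
  c = chop (All.universal N⊎M bs)
  single : ∀ {b x} → x ∈ concatMap fib [ b ] → x ∈ fib b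
  single {b} x∈ = [ id , (λ ()) ]′ (∈-++⁻ (fib b) x∈)
  runs : ∀ ps → concatMap body ps ⊆ bs → All (λ p → InLevel (suc r) e (concatMap fib (run p))) ps
  runs [] _ = []
  runs (p ∷ ps) ps⊆ =
    InLevel-mono (n≤1+n r) (bounded e fib (run p) indep λ K →
      ¬KN (Minor-⊆ (⊆-trans (++⁺ʳ [ cut p ] ⊆-refl) (⊆-trans (++⁺ʳ (concatMap body ps) ⊆-refl) ps⊆)) (Minor-mark (run-P p) K)))
    ∷ runs ps (⊆-trans (++⁺ˡ (body p) ⊆-refl) ps⊆)
  below : ∀ p {x} → x ∈ labelled (λ p → concatMap fib (run p) ++ concatMap fib [ cut p ]) p → proj₁ x ∈ concatMap fib (body (proj₁ p))
  below (p , i) x∈ = go (∈-map⁻ _ x∈)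
    where
    go : ∀ {x} → (∃ λ a → a ∈ concatMap fib (run p) ++ concatMap fib [ cut p ] × x ≡ (a , i)) → proj₁ x ∈ concatMap fib (body p)
    go (_ , a∈ , refl) = subst (_ ∈_) (sym (concatMap-++ fib (run p) [ cut p ])) a∈
  flat-covers : concatMap (λ p → concatMap fib (run p) ++ concatMap fib [ cut p ]) (pieces c) ++ concatMap fib (rest c) ≡ concatMap fib bs
  flat-covers = begin
    concatMap (λ p → concatMap fib (run p) ++ concatMap fib [ cut p ]) (pieces c) ++ concatMap fib (rest c)
      ≡⟨ cong (_++ concatMap fib (rest c)) (concatMap-cong (λ p → sym (concatMap-++ fib (run p) [ cut p ])) (pieces c)) ⟩
    concatMap (concatMap fib ∘ body) (pieces c) ++ concatMap fib (rest c)
      ≡⟨ cong (_++ concatMap fib (rest c)) (concatMap-∘ fib body (pieces c)) ⟩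
    concatMap fib (concatMap body (pieces c)) ++ concatMap fib (rest c)
      ≡⟨ sym (concatMap-++ fib (concatMap body (pieces c)) (rest c)) ⟩
    concatMap fib (concatMap body (pieces c) ++ rest c)
      ≡⟨ cong (concatMap fib) (covers c) ⟩
    concatMap fib bs ∎
    where open ≡-Reasoning

-- The tree of intervals

-- Vertices are labelled with their paths in the tree: the length of the common prefix of two paths is the
-- depth of the smallest interval containing both vertices.
even-prefix : List ℕ → List ℕ → Bool
even-prefix (i ∷ p) (j ∷ p′) = if ⌊ i ≟ j ⌋ then not (even-prefix p p′) else true
even-prefix _ _ = true

parity : Mask (List ℕ)
parity = record { mask = even-prefix ; mask-sym = even-prefix-sym }
  where
  even-prefix-sym : ∀ p p′ → even-prefix p p′ ≡ even-prefix p′ p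
  even-prefix-sym [] [] = refl
  even-prefix-sym [] (_ ∷ _) = refl
  even-prefix-sym (_ ∷ _) [] = refl
  even-prefix-sym (i ∷ p) (j ∷ p′) = cong₂ (λ b c → if b then not c else true) (mask-sym same i j) (even-prefix-sym p p′)

Vertex : Set → Set
Vertex A = A × List ℕ

tag : ℕ → Vertex A → Vertex A
tag i (x , p) = x , i ∷ p

data HasTag {A : Set} (i : ℕ) : Vertex A → Set where
  hasTag : ∀ {x p} → HasTag i (x , i ∷ p)

data TagFrom {A : Set} (i : ℕ) : Vertex A → Set where
  tagFrom : ∀ {x j p} → i ≤ j → TagFrom i (x , j ∷ p)

TagFrom-weaken : ∀ {i j} {v : Vertex A} → i ≤ j → TagFrom j v → TagFrom i v
TagFrom-weaken i≤j (tagFrom j≤k) = tagFrom (≤-trans i≤j j≤k)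

HasTag⇒TagFrom : ∀ {i} {v : Vertex A} → HasTag i v → TagFrom i v
HasTag⇒TagFrom hasTag = tagFrom ≤-refl

tag-HasTag : ∀ i (vs : List (Vertex A)) → All (HasTag i) (map (tag i) vs)
tag-HasTag i vs = Allₚ.map⁺ (All.universal (λ _ → hasTag) vs)

retag : ℕ → Item (Vertex A) → Item (Vertex A)
retag i (vs , b) = map (tag i) vs , b

retag-bodies : ∀ i (ss : List (Item (Vertex A))) → concatMap proj₁ (map (retag i) ss) ≡ map (tag i) (concatMap proj₁ ss)
retag-bodies i [] = refl
retag-bodies i (s ∷ ss) = trans (cong (map (tag i) (proj₁ s) ++_) (retag-bodies i ss)) (sym (map-++ (tag i) (proj₁ s) _))

untag : ∀ i (vs : List (Vertex A)) → map proj₁ (map (tag i) vs) ≡ map proj₁ vs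
untag i [] = refl
untag i (v ∷ vs) = cong (proj₁ v ∷_) (untag i vs)

lift-NoEdge : {e : SymRel A} {m : Mask K} {xs ys : List (A × K)} {zs : List A} →
              NoEdge e (map proj₁ xs) zs → (∀ {y} → y ∈ ys → proj₁ y ∈ zs) → NoEdge (e ↾ m) xs ys
lift-NoEdge {e = e} {m} ne ys⊆ = noEdge λ x∈ y∈ → ↾-false e m (absent ne (∈-map⁺ proj₁ x∈) (ys⊆ y∈))

-- The even and the odd edge set

module Parity {A : Set} (e : SymRel A) where

  Even Odd : SymRel (Vertex A)
  Even = e ↾ parity
  Odd  = e ↾ ∁ parity

  -- A common first tag lengthens the common prefix by one, so passing from an interval to its
  -- parent swaps the two edge sets.
  Even-tag : ∀ i x y → rel Even (tag i x) (tag i y) ≡ rel Odd x y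
  Even-tag i (x , p) (y , p′) rewrite same-refl i = refl

  Odd-tag : ∀ i x y → rel Odd (tag i x) (tag i y) ≡ rel Even x y
  Odd-tag i (x , p) (y , p′) rewrite same-refl i = cong (rel e x y ∧_) (not-involutive _)

  -- Different first tags leave an empty common prefix, of even length.
  Odd-apart : ∀ {i} {vs ws : List (Vertex A)} → All (HasTag i) vs → All (TagFrom (suc i)) ws → NoEdge Odd vs ws
  Odd-apart {i} tagged from = noEdge λ x∈ y∈ → go (All.lookup tagged x∈) (All.lookup from y∈)
    where
    go : ∀ {v w} → HasTag i v → TagFrom (suc i) w → rel Odd v w ≡ false
    go (hasTag {x} {p}) (tagFrom {y} {j} {p′} i<j) rewrite same-≢ (<⇒≢ i<j) = ∧-zeroʳ (rel e x y)

  Even-retag : ∀ i {vs ws : List (Vertex A)} → NoEdge Odd vs ws → NoEdge Even (map (tag i) vs) (map (tag i) ws)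
  Even-retag i {vs} {ws} ne = noEdge λ x∈ y∈ → go (∈-map⁻ (tag i) x∈) (∈-map⁻ (tag i) y∈)
    where
    go : ∀ {x y} → (∃ λ v → v ∈ vs × x ≡ tag i v) → (∃ λ w → w ∈ ws × y ≡ tag i w) → rel Even x y ≡ false
    go (v , v∈ , refl) (w , w∈ , refl) = trans (Even-tag i v w) (absent ne v∈ w∈)

module Decomposition {A B : Set} (e : SymRel A) (fib : B → List A)
                     (indep : ∀ b → NoEdge e (fib b) (fib b)) (r : ℕ) where

  open Parity e

  flat : List B → List A
  flat = concatMap fib

  ℓ : ℕ
  -- `doubly-marked` gives 6 + r, and `chopped` adds 5.
  ℓ = 11 + r

  -- The items are the children of I; the flagged ones are the runs, the others are single blocks.  Z lists
  -- the blocks outside I.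
  record Tree (Z I : List B) : Set where
    field
      items    : List (Item (Vertex A))
      under    : map proj₁ (concatMap proj₁ items) ≡ flat I
      apart    : AllPairs (Apart Odd) items
      closed   : All (λ s → proj₂ s ≡ true → Closure ℓ Odd (proj₁ s)) items
      kept     : All (λ s → proj₂ s ≡ false → Apart Odd s s) items
      isolated : All (λ s → proj₂ s ≡ true → NoEdge e (map proj₁ (proj₁ s)) (flat Z)) items
      whole    : Closure ℓ Even (concatMap proj₁ items)

    bodies : List (Vertex A)
    bodies = concatMap proj₁ items

    ∈-under : ∀ {s x} → s ∈ items → x ∈ proj₁ s → proj₁ x ∈ flat I
    ∈-under s∈ x∈ = subst (_ ∈_) under (∈-map⁺ proj₁ (∈-flat⁺ proj₁ s∈ x∈))
  open Tree

  empty : ∀ {Z} → Tree Z []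
  empty = record
    { items = [] ; under = refl ; apart = [] ; closed = [] ; kept = [] ; isolated = []
    ; whole = base (inLevel (Level-mono z≤n refl)) }

  -- Odd edges stay inside single items, so they form a disjoint union, while `whole` covers the
  -- even ones. The closures cost one level and the edge union another.
  Tree⇒InLevel : ∀ {Z I} → Tree Z I → InLevel (2 + ℓ) e (flat I)
  Tree⇒InLevel d = subst (InLevel _ e) (under d)
    (edge-union parity (Closure⇒InLevel (whole d))
      (Closure⇒InLevel (disjoint-union (s≤s z≤n) (closed d) (kept d) (apart d))))

  block : ℕ → B → List (Vertex A)
  block i b = map (_, [ i ]) (fib b)

  block-HasTag : ∀ i b → All (HasTag i) (block i b)
  block-HasTag i b = Allₚ.map⁺ (All.universal (λ _ → hasTag) (fib b))

  block-under : ∀ i b → map proj₁ (block i b) ≡ fib b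
  block-under i b = go (fib b)
    where
    go : ∀ xs → map proj₁ (map (_, [ i ]) xs) ≡ xs
    go [] = refl
    go (x ∷ xs) = cong (x ∷_) (go xs)

  block-∈ : ∀ i b {x} → x ∈ block i b → proj₁ x ∈ fib b
  block-∈ i b x∈ = subst (_ ∈_) (block-under i b) (∈-map⁺ proj₁ x∈)

  block-independent : ∀ i b {m : Mask (List ℕ)} → NoEdge (e ↾ m) (block i b) (block i b)
  block-independent i b = lift-NoEdge (subst (λ xs → NoEdge e xs (fib b)) (sym (block-under i b)) (indep b)) (block-∈ i b)

  -- A run with the separator after it, as it looks once the runs among the grandchildren are
  -- contracted: `heads` is what remains of the run. As a unit it serves as one block for the
  -- induction hypothesis, standing for the original `blocks`.
  record ChildPiece (M : B → Set) : Set where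
    field
      heads         : List (Vertex A)
      heads-indep   : NoEdge Even heads heads
      separator     : List (Vertex A)
      sep-indep     : NoEdge Even separator separator
      blocks        : List B
      below         : ∀ {x} → x ∈ heads ++ separator → proj₁ x ∈ flat blocks
      mark          : B
      mark-M        : M mark
      mark∈blocks   : mark ∈ blocks
  open ChildPiece

  content : {M : B → Set} → ChildPiece M → List (Vertex A)
  content p = heads p ++ separator p

  -- The children of an interval lying between L and R; Z is what is outside the whole parent interval.
  data Children (Z R : List B) (M : B → Set) : List B → List B → Set where
    last : ∀ {L T} → NoEdge e (flat T) (flat Z) → Tree (L ++ R) T → Children Z R M L T
    more : ∀ {L S m I} → NoEdge e (flat S) (flat Z) → M m → Tree (L ++ m ∷ I ++ R) S →
           Children Z R M (L ++ S ++ [ m ]) I → Children Z R M L (S ++ m ∷ I)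

  module _ {Z R : List B} {M : B → Set} where

    childItems : ∀ {L I} → ℕ → Children Z R M L I → List (Item (Vertex A))
    childItems i (last _ d) = (map (tag i) (bodies d) , true) ∷ []
    childItems i (more {m = m} _ _ d k) = (map (tag i) (bodies d) , true) ∷ (block (suc i) m , false) ∷ childItems (2 + i) k

    -- Edges assigned to the children are odd, so the even graph is contracted two levels down: each
    -- run is replaced by its own items.
    grandItems : ∀ {L I} → ℕ → Children Z R M L I → List (Item (Vertex A))
    grandItems i (last _ d) = map (retag i) (items d)
    grandItems i (more {m = m} _ _ d k) = map (retag i) (items d) ++ (block (suc i) m , false) ∷ grandItems (2 + i) k

    same-bodies : ∀ {L I} i (k : Children Z R M L I) → concatMap proj₁ (grandItems i k) ≡ concatMap proj₁ (childItems i k)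
    same-bodies i (last _ d) = trans (retag-bodies i (items d)) (sym (++-identityʳ _))
    same-bodies i (more {m = m} _ _ d k) =
      trans (concatMap-++ proj₁ (map (retag i) (items d)) _)
        (cong₂ _++_ (retag-bodies i (items d)) (cong (block (suc i) m ++_) (same-bodies (2 + i) k)))

    child-under : ∀ {L I} i (k : Children Z R M L I) → map proj₁ (concatMap proj₁ (childItems i k)) ≡ flat I
    child-under i (last _ d) = trans (cong (map proj₁) (++-identityʳ _)) (trans (untag i _) (under d))
    child-under i (more {S = S} {m} {I} _ _ d k) = begin
      map proj₁ (map (tag i) (bodies d) ++ block (suc i) m ++ rest′)
        ≡⟨ map-++ proj₁ (map (tag i) (bodies d)) _ ⟩
      map proj₁ (map (tag i) (bodies d)) ++ map proj₁ (block (suc i) m ++ rest′)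
        ≡⟨ cong₂ _++_ (trans (untag i _) (under d)) (map-++ proj₁ (block (suc i) m) _) ⟩
      flat S ++ map proj₁ (block (suc i) m) ++ map proj₁ rest′
        ≡⟨ cong (flat S ++_) (cong₂ _++_ (block-under (suc i) m) (child-under (2 + i) k)) ⟩
      flat S ++ flat (m ∷ I)
        ≡⟨ sym (concatMap-++ fib S (m ∷ I)) ⟩
      flat (S ++ m ∷ I) ∎
      where
      open ≡-Reasoning
      rest′ = concatMap proj₁ (childItems (2 + i) k)

    child-tags : ∀ {L I} i (k : Children Z R M L I) → All (λ s → All (TagFrom i) (proj₁ s)) (childItems i k)
    child-tags i (last _ d) = All.map HasTag⇒TagFrom (tag-HasTag i _) ∷ []
    child-tags i (more {m = m} _ _ d k) =
      All.map HasTag⇒TagFrom (tag-HasTag i _)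
      ∷ All.map (TagFrom-weaken (n≤1+n i) ∘ HasTag⇒TagFrom) (block-HasTag (suc i) m)
      ∷ All.map (All.map (TagFrom-weaken (m≤n+m i 2))) (child-tags (2 + i) k)

    child-apart : ∀ {L I} i (k : Children Z R M L I) → AllPairs (Apart Odd) (childItems i k)
    child-apart i (last _ d) = [] ∷ []
    child-apart i (more {m = m} _ _ d k) =
      (Odd-apart (tag-HasTag i _) (All.map HasTag⇒TagFrom (block-HasTag (suc i) m))
        ∷ All.map (λ from → Odd-apart (tag-HasTag i _) (All.map (TagFrom-weaken (n≤1+n _)) from)) (child-tags (2 + i) k))
      ∷ All.map (Odd-apart (block-HasTag (suc i) m)) (child-tags (2 + i) k)
      ∷ child-apart (2 + i) k

    child-closed : ∀ {L I} i (k : Children Z R M L I) → All (λ s → proj₂ s ≡ true → Closure ℓ Odd (proj₁ s)) (childItems i k)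
    child-closed i (last _ d) = (λ _ → Closure-map (tag i) (Odd-tag i) (whole d)) ∷ []
    child-closed i (more _ _ d k) = (λ _ → Closure-map (tag i) (Odd-tag i) (whole d)) ∷ (λ ()) ∷ child-closed (2 + i) k

    child-kept : ∀ {L I} i (k : Children Z R M L I) → All (λ s → proj₂ s ≡ false → Apart Odd s s) (childItems i k)
    child-kept i (last _ d) = (λ ()) ∷ []
    child-kept i (more {m = m} _ _ d k) = (λ ()) ∷ (λ _ → block-independent (suc i) m) ∷ child-kept (2 + i) k

    child-isolated : ∀ {L I} i (k : Children Z R M L I) →
                     All (λ s → proj₂ s ≡ true → NoEdge e (map proj₁ (proj₁ s)) (flat Z)) (childItems i k)
    child-isolated i (last ne d) =
      (λ _ → subst (λ xs → NoEdge e xs (flat Z)) (sym (trans (untag i _) (under d))) ne) ∷ []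
    child-isolated i (more ne _ d k) =
      (λ _ → subst (λ xs → NoEdge e xs (flat Z)) (sym (trans (untag i _) (under d))) ne) ∷ (λ ()) ∷ child-isolated (2 + i) k

    retag-isolated : ∀ {X Y I} i (d : Tree X I) → (∀ {b} → b ∈ Y → b ∈ X) →
                     All (λ s → proj₂ s ≡ true → NoEdge e (map proj₁ (proj₁ s)) (flat Y)) (map (retag i) (items d))
    retag-isolated {X} {Y} i d Y⊆X = Allₚ.map⁺ (All.map shift (isolated d))
      where
      shift : ∀ {s} → (proj₂ s ≡ true → NoEdge e (map proj₁ (proj₁ s)) (flat X)) →
              proj₂ s ≡ true → NoEdge e (map proj₁ (map (tag i) (proj₁ s))) (flat Y)
      shift {s} iso flagged =
        subst (λ xs → NoEdge e xs (flat Y)) (sym (untag i (proj₁ s))) (NoEdge-⊆ id (flat-⊆ fib Y X Y⊆X) (iso flagged))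

    retag-under : ∀ {X I} i (d : Tree X I) → All (λ s → All (λ x → proj₁ x ∈ flat I) (proj₁ s)) (map (retag i) (items d))
    retag-under i d = Allₚ.map⁺ (All.tabulate λ s∈ → Allₚ.map⁺ (All.tabulate λ x∈ → ∈-under d s∈ x∈))

    -- Only the left side is recorded: `L` grows along `Children`, so this covers all earlier
    -- siblings in `grand-separated`. What lies to the right of a run is read off its own tree.
    grand-isolated : ∀ {L I} i (k : Children Z R M L I) →
                     All (λ s → proj₂ s ≡ true → NoEdge e (map proj₁ (proj₁ s)) (flat L)) (grandItems i k)
    grand-isolated {L} i (last _ d) = retag-isolated {Y = L} i d ∈-++⁺ˡ
    grand-isolated {L} i (more {S = S} {m} _ _ d k) =
      Allₚ.++⁺ (retag-isolated {Y = L} i d ∈-++⁺ˡ)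
        ((λ ()) ∷ All.map (λ iso flagged → NoEdge-⊆ id (flat-⊆ fib L (L ++ S ++ [ m ]) ∈-++⁺ˡ) (iso flagged)) (grand-isolated (2 + i) k))

    grand-under : ∀ {L I} i (k : Children Z R M L I) → All (λ s → All (λ x → proj₁ x ∈ flat I) (proj₁ s)) (grandItems i k)
    grand-under i k = All.tabulate λ s∈ → All.tabulate λ x∈ →
      subst (_ ∈_) (trans (cong (map proj₁) (same-bodies i k)) (child-under i k)) (∈-map⁺ proj₁ (∈-flat⁺ proj₁ s∈ x∈))

    retag-separated : ∀ {X I} i (d : Tree X I) → AllPairs (Separated Even) (map (retag i) (items d))
    retag-separated i d = AllPairsₚ.map⁺ (AllPairs.map (λ ne _ → Even-retag i ne) (apart d))

    separate : ∀ {s t : Item (Vertex A)} {xs ys : List A} →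
               (proj₂ s ≡ true → NoEdge e (map proj₁ (proj₁ s)) ys) → All (λ y → proj₁ y ∈ ys) (proj₁ t) →
               (proj₂ t ≡ true → NoEdge e (map proj₁ (proj₁ t)) xs) → All (λ x → proj₁ x ∈ xs) (proj₁ s) →
               Separated Even s t
    separate iso-s t⊆ iso-t s⊆ (inj₁ flagged) = lift-NoEdge (iso-s flagged) (All.lookup t⊆)
    separate iso-s t⊆ iso-t s⊆ (inj₂ flagged) = NoEdge-sym (lift-NoEdge (iso-t flagged) (All.lookup s⊆))

    -- Items of the same run have only odd edges between them, by `apart` and retagging. For items
    -- under different children, a flagged one has no neighbour outside its parent run.
    grand-separated : ∀ {L I} i (k : Children Z R M L I) → AllPairs (Separated Even) (grandItems i k)
    grand-separated i (last _ d) = retag-separated i d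
    grand-separated {L} i (more {S = S} {m} {I} _ _ d k) =
      AllPairsₚ.++⁺ (retag-separated i d)
        (All.zipWith (λ (iso , sub) → separate {xs = flat (L ++ S ++ [ m ])} {ys = flat I} (λ ()) sub iso (All.tabulate (λ x∈ →
            ∈-flat⁺ fib (∈-++⁺ʳ L (∈-++⁺ʳ S (here refl))) (block-∈ (suc i) m x∈))))
          (grand-isolated (2 + i) k , grand-under (2 + i) k)
          ∷ grand-separated (2 + i) k)
        (All.zipWith (λ (iso , sub) →
            separate {xs = flat S} {ys = flat (m ∷ I)} iso (All.tabulate (λ x∈ → ∈-++⁺ˡ (block-∈ (suc i) m x∈))) (λ ()) sub
            ∷ All.zipWith (λ (iso′ , sub′) → separate {xs = flat (L ++ S ++ [ m ])} {ys = flat (m ∷ I)} iso (All.map (∈-++⁺ʳ (fib m)) sub′) iso′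
                 (All.map (flat-⊆ fib S (L ++ S ++ [ m ]) (∈-++⁺ʳ L ∘ ∈-++⁺ˡ)) sub))
              (grand-isolated (2 + i) k , grand-under (2 + i) k))
          (retag-isolated {Y = m ∷ I} i d (λ b∈ → ∈-++⁺ʳ L (∈-++⁺ˡ b∈)) , retag-under i d))

    heads-of : ∀ {X I} → ℕ → Tree X I → List (Vertex A)
    heads-of i d = concatMap rep (map (retag i) (items d))

    -- Edges between items of one run are assigned to that run, hence odd; a contracted item is at
    -- most one vertex, and the others are independent blocks.
    heads-independent : ∀ {X I} i (d : Tree X I) → NoEdge Even (heads-of i d) (heads-of i d)
    heads-independent i d = reps-independent
      (Allₚ.map⁺ (All.map (λ ne unflagged → Even-retag i (ne unflagged)) (kept d)))
      (AllPairsₚ.map⁺ (AllPairs.map (Even-retag i) (apart d)))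

    heads-under : ∀ {X I} i (d : Tree X I) {x} → x ∈ heads-of i d → proj₁ x ∈ flat I
    heads-under i d x∈ =
      let s , s∈ , x∈s = ∈-reps (map (retag i) (items d)) x∈
      in All.lookup (All.lookup (retag-under i d) s∈) (rep-⊆ s x∈s)

    childPieces : ∀ {L I} → ℕ → Children Z R M L I → List (ChildPiece M)
    childPieces i (last _ d) = []
    childPieces i (more {S = S} {m} _ mark d k) = record
      { heads = heads-of i d ; heads-indep = heads-independent i d
      ; separator = block (suc i) m ; sep-indep = block-independent (suc i) m
      ; blocks = S ++ [ m ]
      ; below = λ x∈ → [ (λ x∈h → flat-⊆ fib S (S ++ [ m ]) ∈-++⁺ˡ (heads-under i d x∈h))
                       , (λ x∈b → ∈-flat⁺ fib (∈-++⁺ʳ S (here refl)) (block-∈ (suc i) m x∈b)) ]′ (∈-++⁻ (heads-of i d) x∈)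
      ; mark = m ; mark-M = mark ; mark∈blocks = ∈-++⁺ʳ S (here refl) }
      ∷ childPieces (2 + i) k

    tail-heads : ∀ {L I} → ℕ → Children Z R M L I → List (Vertex A)
    tail-heads i (last _ d) = heads-of i d
    tail-heads i (more _ _ _ k) = tail-heads (2 + i) k

    tail-independent : ∀ {L I} i (k : Children Z R M L I) → NoEdge Even (tail-heads i k) (tail-heads i k)
    tail-independent i (last _ d) = heads-independent i d
    tail-independent i (more _ _ _ k) = tail-independent (2 + i) k

    grand-reps : ∀ {L I} i (k : Children Z R M L I) →
                 concatMap content (childPieces i k) ++ tail-heads i k ≡ concatMap rep (grandItems i k)
    grand-reps i (last _ d) = refl
    grand-reps i k₀@(more {m = m} _ _ d k) = begin
      ((heads-of i d ++ block (suc i) m) ++ pieces′) ++ tail-heads (2 + i) k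
        ≡⟨ ++-assoc (heads-of i d ++ block (suc i) m) pieces′ _ ⟩
      (heads-of i d ++ block (suc i) m) ++ pieces′ ++ tail-heads (2 + i) k
        ≡⟨ cong ((heads-of i d ++ block (suc i) m) ++_) (grand-reps (2 + i) k) ⟩
      (heads-of i d ++ block (suc i) m) ++ concatMap rep (grandItems (2 + i) k)
        ≡⟨ ++-assoc (heads-of i d) (block (suc i) m) _ ⟩
      heads-of i d ++ block (suc i) m ++ concatMap rep (grandItems (2 + i) k)
        ≡⟨ sym (concatMap-++ rep (map (retag i) (items d)) _) ⟩
      concatMap rep (grandItems i k₀) ∎
      where
      open ≡-Reasoning
      pieces′ = concatMap content (childPieces (2 + i) k)

    pieces-within : ∀ {L I} i (k : Children Z R M L I) → concatMap blocks (childPieces i k) ⊆ I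
    pieces-within i (last {T = T} _ d) = minimum T
    pieces-within i (more {S = S} {m} {I} _ _ d k) =
      ⊆-trans (++⁺ (⊆-refl {x = S ++ [ m ]}) (pieces-within (2 + i) k)) (⊆-reflexive (++-assoc S [ m ] I))

    -- After contraction the even graph alternates between independent `heads` and separators, so
    -- `chopped` reduces it to the cross edges bounded by hypothesis; `expand` undoes the
    -- contraction.
    graft : ∀ {L I} (k : Children Z R M L I) →
            InLevel (6 + r) (cross Even) (concatMap (labelled content) (number 0 (childPieces 0 k))) → Tree Z I
    graft k c = record
      { items = childItems 0 k ; under = child-under 0 k ; apart = child-apart 0 k
      ; closed = child-closed 0 k ; kept = child-kept 0 k ; isolated = child-isolated 0 k
      ; whole = subst (Closure ℓ Even) (same-bodies 0 k)
          (expand Even [] (grand-closed 0 k) (grand-separated 0 k)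
            (base (subst (InLevel ℓ Even) (grand-reps 0 k)
              (chopped (s≤s z≤n) heads separator
                (All.universal (λ p → InLevel-mono (s≤s z≤n) (independent (heads-indep p))) (childPieces 0 k))
                sep-indep (InLevel-mono (s≤s z≤n) (independent (tail-independent 0 k))) c)))) }
      where
      retag-closed : ∀ {X I} i (d : Tree X I) →
        All (λ s → proj₂ s ≡ true → Closure ℓ Even (proj₁ s) × NoEdge Even (proj₁ s) []) (map (retag i) (items d))
      retag-closed i d = Allₚ.map⁺ (All.map
        (λ c flagged → Closure-map (tag i) (Even-tag i) (c flagged) , noEdge λ _ ()) (closed d))
      grand-closed : ∀ {L I} i (k : Children Z R M L I) →
        All (λ s → proj₂ s ≡ true → Closure ℓ Even (proj₁ s) × NoEdge Even (proj₁ s) []) (grandItems i k)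
      grand-closed i (last _ d) = retag-closed i d
      grand-closed i (more _ _ d k) = Allₚ.++⁺ (retag-closed i d) ((λ ()) ∷ grand-closed (2 + i) k)

-- Extending minors by the outside of an interval

edges? : (e : SymRel A) (xs ys : List A) → NoEdge e xs ys ⊎ ∃ λ x → ∃ λ y → x ∈ xs × y ∈ ys × rel e x y ≡ true
edges? e xs ys with Any.any? (λ x → Any.any? (λ y → rel e x y Bool.≟ true) ys) xs
... | yes p = let x , x∈ , p′ = find p ; y , y∈ , xy = find p′ in inj₂ (x , y , x∈ , y∈ , xy)
... | no ¬p = inj₁ (noEdge λ x∈ y∈ → ¬-not λ xy → ¬p (lose x∈ (lose y∈ xy)))

module _ {e : SymRel A} {fib : B → List A} where

  Linked-left : ∀ bs cs → Linked e fib bs cs → Any Anything bs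
  Linked-left (b ∷ bs) _ _ = here tt

  Linked-right : ∀ bs cs → Linked e fib bs cs → Any Anything cs
  Linked-right _ (c ∷ cs) _ = here tt
  Linked-right _ [] (_ , _ , _ , () , _)

  prepend : ∀ {L I} → Minor (λ b → Linked e fib L [ b ]) (suc t) e fib I → Minor Anything (2 + t) e fib (L ++ I)
  prepend {L = L} K = record
    { parts = L ∷ parts K
    ; count = cong suc (count K)
    ; within = ++⁺ ⊆-refl (within K)
    ; marked = nonempty (parts K) (count K) links ∷ All.map (Any.map (λ _ → tt)) (marked K)
    ; linked = links ∷ linked K }
    where
    attach : ∀ {bs} → Any (λ b → Linked e fib L [ b ]) bs → Linked e fib L bs
    attach {bs} m = let b , b∈ , (x , y , x∈ , y∈ , xy) = find m
                    in x , y , x∈ , flat-⊆ fib [ b ] bs (λ { (here refl) → b∈ }) y∈ , xy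
    links : All (Linked e fib L) (parts K)
    links = All.map attach (marked K)
    -- With at least one part present, its edge to `L` shows that the new part `L` is nonempty.
    nonempty : ∀ yss {t} → length yss ≡ suc t → All (Linked e fib L) yss → Any Anything L
    nonempty (ys ∷ _) _ (l ∷ _) = Linked-left L ys l

  append : ∀ {I R} → Minor (λ b → Linked e fib [ b ] R) (suc t) e fib I → Minor Anything (2 + t) e fib (I ++ R)
  append {t = t} {I = I} {R} K = record
    { parts = parts K ++ [ R ]
    ; count = trans (length-++ (parts K)) (trans (+-comm _ 1) (cong suc (count K)))
    ; within = ⊆-trans (⊆-reflexive (trans (sym (concat-++ (parts K) [ R ])) (cong (concat (parts K) ++_) (++-identityʳ R))))
                 (++⁺ (within K) ⊆-refl)
    ; marked = Allₚ.++⁺ (All.map (Any.map (λ _ → tt)) (marked K)) (nonempty (parts K) (count K) links ∷ [])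
    ; linked = AllPairsₚ.++⁺ (linked K) ([] ∷ []) (All.map (_∷ []) links) }
    where
    attach : ∀ {bs} → Any (λ b → Linked e fib [ b ] R) bs → Linked e fib bs R
    attach {bs} m = let b , b∈ , (x , y , x∈ , y∈ , xy) = find m
                    in x , y , flat-⊆ fib [ b ] bs (λ { (here refl) → b∈ }) x∈ , y∈ , xy
    links : All (λ bs → Linked e fib bs R) (parts K)
    links = All.map attach (marked K)
    nonempty : ∀ yss {t} → length yss ≡ suc t → All (λ bs → Linked e fib bs R) yss → Any Anything R
    nonempty (ys ∷ _) _ (l ∷ _) = Linked-right ys R l

-- Construction of the tree

module _ {A B : Set} (e : SymRel A) (fib : B → List A) (indep : ∀ b → NoEdge e (fib b) (fib b))
         {r t : ℕ} (bounded : BoundedRank (suc t) r) (all : List B) (¬K : ¬ Minor Anything (2 + t) e fib all) where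

  open Decomposition e fib indep r
  open Parity e

  Left Right : List B → B → Set
  Left L b = Linked e fib L [ b ]
  Right R b = Linked e fib [ b ] R

  -- A minor with `suc t` parts, all seeing `L`, is completed by `L` to one with `2 + t` parts,
  -- against `¬K`; likewise with `R`. So `doubly-marked` applies with whole pieces as blocks, marked
  -- by their separators.
  marked-cross : ∀ {Z L I R} → L ++ I ++ R ⊆ all → (k : Children Z R (λ b → Right R b ⊎ Left L b) L I) →
                 InLevel (6 + r) (cross Even) (concatMap (labelled content) (number 0 (childPieces 0 k)))
  marked-cross {L = L} {I} {R} ⊆all k =
    doubly-marked {M = λ p → Left L (mark (proj₁ p))} {N = λ p → Right R (mark (proj₁ p))}
      bounded (labelled-independent content) (λ p → mark-M (proj₁ p))
      (λ K → ¬K (Minor-⊆ (⊆-trans (++⁺ (⊆-refl {x = L}) (++⁺ʳ R ⊆-refl)) ⊆all)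
                  (prepend (blow-up (λ {p} l → lose (mark∈blocks (proj₁ p)) l) K))))
      (λ K → ¬K (Minor-⊆ (⊆-trans (++⁺ˡ L ⊆-refl) ⊆all)
                  (append (blow-up (λ {p} l → lose (mark∈blocks (proj₁ p)) l) K))))
    where
    open ChildPiece
    blow-up : ∀ {M : B → Set} {M′ : ChildPiece (λ b → Right R b ⊎ Left L b) × ℕ → Set} →
              (∀ {p} → M′ p → Any M (blocks (proj₁ p))) →
              Minor M′ (suc t) (cross Even) (labelled content) (number 0 (childPieces 0 k)) → Minor M (suc t) e fib I
    blow-up M′⇒M = Minor-map (blocks ∘ proj₁) (proj₁ ∘ proj₁) 
      (λ {x} {y} xy → ↾-true e parity {proj₁ x} {proj₁ y} (↾-true Even (∁ same) {x} {y} xy))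
      (λ (p , i) x∈ → under-blocks p (∈-map⁻ (_, i) x∈)) M′⇒M
      (⊆-trans (⊆-reflexive (unnumber blocks 0 (childPieces 0 k))) (pieces-within 0 k))
      where
      under-blocks : ∀ p {i x} → (∃ λ a → a ∈ content p × x ≡ (a , i)) → proj₁ (proj₁ x) ∈ flat (blocks p)
      under-blocks p (_ , a∈ , refl) = below p a∈

  lone-cross : ∀ {M} (ps : List (ChildPiece M)) → length ps ≡ 1 →
               InLevel (6 + r) (cross Even) (concatMap (labelled content) (number 0 ps))
  lone-cross (p ∷ []) _ = InLevel-mono (s≤s z≤n) (independent
    (subst (λ vs → NoEdge (cross Even) vs vs) (sym (++-identityʳ _)) (labelled-independent content (p , 0))))

  Isolated : List B → B → Set
  Isolated Z b = NoEdge e (fib b) (flat Z)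

  classify : ∀ L R b → Isolated (L ++ R) b ⊎ (Right R b ⊎ Left L b)
  classify L R b with edges? e (fib b) (flat L) | edges? e (fib b) (flat R)
  ... | inj₂ (x , y , x∈ , y∈ , xy) | _ = inj₂ (inj₂ (y , x , y∈ , ∈-++⁺ˡ x∈ , trans (symm e y x) xy))
  ... | inj₁ _ | inj₂ (x , y , x∈ , y∈ , xy) = inj₂ (inj₁ (x , y , ∈-++⁺ˡ x∈ , y∈ , xy))
  ... | inj₁ ne | inj₁ ne′ = inj₁ (subst (NoEdge e (fib b)) (sym (concatMap-++ fib L R)) (NoEdge-++ʳ (flat L) ne ne′))

  Isolated-flat : ∀ Z I → All (Isolated Z) I → NoEdge e (flat I) (flat Z)
  Isolated-flat Z I iso = noEdge λ x∈ → let b , b∈ , x∈b = ∈-flat⁻ fib I x∈ in absent (All.lookup iso b∈) x∈b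

  -- The bound `n` is there for termination: every run omits at least one separator of its interval.
  -- `L` and `R` together hold everything outside `I`, which is what minors are extended by.
  decompose : ∀ n L I R → length I ≤ n → L ++ I ++ R ⊆ all → Tree (L ++ R) I

  children : ∀ n {Z R M} L (ps : List (Piece (Isolated Z) M)) rest → All (Isolated Z) rest →
             All (λ p → length (run p) ≤ n) ps → length rest ≤ n →
             L ++ (concatMap body ps ++ rest) ++ R ⊆ all → Children Z R M L (concatMap body ps ++ rest)
  children n {Z} {R} L [] rest iso [] rest≤n ⊆all =
    last (Isolated-flat Z rest iso) (decompose n L rest R rest≤n ⊆all)
  children n {Z} {R} {M} L (p ∷ ps) rest iso (run≤n ∷ runs≤n) rest≤n ⊆all =
    subst (Children Z R M L) (sym unfold)
      (more (Isolated-flat Z (run p) (run-P p)) (cut-M p)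
        (decompose n L (run p) (cut p ∷ I ++ R) run≤n
          (subst (λ J → L ++ J ⊆ all) (trans (cong (_++ R) unfold) (++-assoc (run p) (cut p ∷ I) R)) ⊆all))
        (children n (L ++ body p) ps rest iso runs≤n rest≤n
          (subst (_⊆ all) (trans (cong (λ J → L ++ J ++ R) (++-assoc (body p) (concatMap body ps) rest))
                            (trans (cong (L ++_) (++-assoc (body p) I R)) (sym (++-assoc L (body p) (I ++ R))))) ⊆all)))
    where
    I = concatMap body ps ++ rest
    unfold : concatMap body (p ∷ ps) ++ rest ≡ run p ++ cut p ∷ I
    unfold = trans (++-assoc (body p) (concatMap body ps) rest) (++-assoc (run p) [ cut p ] I)

  decompose n L [] R I≤n ⊆all = empty
  decompose (suc n) L (b ∷ I) R (s≤s I≤n) ⊆all = by-chop (chop (All.universal (classify L R) (b ∷ I)))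
    where
    Z = L ++ R
    by-chop : Chop (Isolated Z) (λ b → Right R b ⊎ Left L b) (b ∷ I) → Tree Z (b ∷ I)
    -- When nothing has a neighbour outside, the first block plays the role of the separator.
    by-chop record { pieces = [] ; rest-P = iso ; covers = refl } =
      graft k (lone-cross (childPieces 0 k) refl)
      where
      k : Children Z R Anything L (b ∷ I)
      k = more {S = []} (noEdge λ ()) tt empty
            (last (Isolated-flat Z I (All.tail iso))
              (decompose n (L ++ [ b ]) I R I≤n (subst (_⊆ all) (sym (++-assoc L [ b ] (I ++ R))) ⊆all)))
    by-chop record { pieces = p ∷ ps ; rest = rs ; rest-P = iso ; covers = eq } =
      subst (Tree Z) eq (graft k (marked-cross (subst (λ J → L ++ J ++ R ⊆ all) (sym eq) ⊆all) k))
      where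
      -- A run fits into `b ∷ I` together with its separator, which gives the strict decrease; for
      -- `rs` the separator of the first piece does the same.
      short : ∀ ps′ → concatMap body ps′ ⊆ b ∷ I → All (λ p → length (run p) ≤ n) ps′
      short [] _ = []
      short (p′ ∷ ps′) sub =
        ≤-trans (s≤s⁻¹ (subst (_≤ suc (length I)) (trans (length-++ (run p′)) (+-comm _ 1))
                  (length-mono-≤ (⊆-trans (++⁺ʳ (concatMap body ps′) ⊆-refl) sub)))) I≤n
        ∷ short ps′ (⊆-trans (++⁺ˡ (body p′) ⊆-refl) sub)
      rs≤n : length rs ≤ n
      rs≤n = ≤-trans (s≤s⁻¹ (length-mono-≤ {as = cut p ∷ rs} (⊆-trans
        (++⁺ (++⁺ʳ (concatMap body ps) (++⁺ˡ (run p) ⊆-refl)) ⊆-refl) (⊆-reflexive eq)))) I≤n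
      k : Children Z R (λ b → Right R b ⊎ Left L b) L (concatMap body (p ∷ ps) ++ rs)
      k = children n L (p ∷ ps) rs iso (short (p ∷ ps) (⊆-trans (++⁺ʳ rs ⊆-refl) (⊆-reflexive eq))) rs≤n
            (subst (λ J → L ++ J ++ R ⊆ all) (sym eq) ⊆all)

-- Induction on the size of the excluded clique

bounded-suc : BoundedRank (suc t) r → BoundedRank (2 + t) (13 + r)
bounded-suc {r = r} bounded e fib bs indep ¬K =
  -- The root is the whole sequence, with nothing on either side; 13 is 2 on top of the 11 in `ℓ`.
  Decomposition.Tree⇒InLevel e fib indep r
    (decompose e fib indep bounded bs ¬K (length bs) [] bs [] ≤-refl (⊆-reflexive (++-identityʳ bs)))

-- A single block is already a K_1 minor, so there are no blocks at all.
bounded-one : BoundedRank 1 0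
bounded-one e fib [] indep ¬K = inLevel refl
bounded-one e fib (b ∷ bs) indep ¬K = ⊥-elim (¬K record
  { parts = [ [ b ] ] ; count = refl ; within = refl ∷ minimum bs ; marked = here tt ∷ [] ; linked = [] ∷ [] })

bounded : ∀ t → ∃ (BoundedRank (suc t))
bounded zero = 0 , bounded-one
bounded (suc t) = let r , b = bounded t in 13 + r , bounded-suc b

-- Interval minors of graphs on Fin n

AllPairs-⊆ : {R : A → A → Set} {xs ys : List A} → xs ⊆ ys → AllPairs R ys → AllPairs R xs
AllPairs-⊆ [] [] = []
AllPairs-⊆ (_ ∷ʳ p) (_ ∷ rs) = AllPairs-⊆ p rs
AllPairs-⊆ (refl ∷ p) (r ∷ rs) = All-resp-⊆ p r ∷ AllPairs-⊆ p rs

AllPairs-lookup : {R : A → A → Set} {xs : List A} → AllPairs R xs →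
                  ∀ {i j} → i F.< j → R (lookup xs i) (lookup xs j)
AllPairs-lookup (r ∷ rs) {zero} {suc j} _ = All.lookup r (∈-lookup j)
AllPairs-lookup (r ∷ rs) {suc i} {suc j} (s≤s i<j) = AllPairs-lookup rs i<j

-- Counts the parts starting at or before x, which extends the parts to a partition of Fin n.
started : ∀ {n} → List (List (Fin n)) → Fin n → ℕ
started [] x = 0
started ([] ∷ yss) x = started yss x
started ((h ∷ _) ∷ yss) x = (if ⌊ h F.≤? x ⌋ then 1 else 0) + started yss x

started-≤ : ∀ {n} yss (x : Fin n) → started yss x ≤ length yss
started-≤ [] x = z≤n
started-≤ ([] ∷ yss) x = m≤n⇒m≤1+n (started-≤ yss x)
started-≤ ((h ∷ _) ∷ yss) x with h F.≤? x
... | yes _ = s≤s (started-≤ yss x)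
... | no _ = m≤n⇒m≤1+n (started-≤ yss x)

started-mono : ∀ {n} yss {x y : Fin n} → x F.≤ y → started yss x ≤ started yss y
started-mono [] x≤y = z≤n
started-mono ([] ∷ yss) x≤y = started-mono yss x≤y
started-mono ((h ∷ _) ∷ yss) {x} {y} x≤y with h F.≤? x | h F.≤? y
... | yes _ | yes _ = s≤s (started-mono yss x≤y)
... | yes h≤x | no h≰y = ⊥-elim (h≰y (≤-trans h≤x x≤y))
... | no _ | yes _ = m≤n⇒m≤1+n (started-mono yss x≤y)
... | no _ | no _ = started-mono yss x≤y

started-none : ∀ {n} yss {x : Fin n} → All (x F.<_) (concat yss) → started yss x ≡ 0
started-none [] _ = refl
started-none ([] ∷ yss) later = started-none yss later
started-none ((h ∷ hs) ∷ yss) {x} (x<h ∷ later) with h F.≤? x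
... | yes h≤x = ⊥-elim (<⇒≱ x<h h≤x)
... | no _ = started-none yss (Allₚ.++⁻ʳ hs later)

-- By sortedness the head of a part is its least element, so at `x` exactly the parts up to its own
-- have started; `ys` is left out of the count, so that numbering begins at 0.
started-part : ∀ {n} {M : Fin n → Set} ys yss {x : Fin n} → All (Any M) yss → AllPairs F._<_ (concat (ys ∷ yss)) →
               ∀ i → x ∈ lookup (ys ∷ yss) i → started yss x ≡ toℕ i
started-part ys yss ne sorted zero x∈ = started-none yss (after-ys ys x∈ sorted)
  where
  after-ys : ∀ ys {x} → x ∈ ys → AllPairs F._<_ (ys ++ concat yss) → All (x F.<_) (concat yss)
  after-ys (y ∷ ys) (here refl) (y< ∷ _) = Allₚ.++⁻ʳ ys y<
  after-ys (y ∷ ys) (there x∈) (_ ∷ rest) = after-ys ys x∈ rest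
started-part ys ((h ∷ hs) ∷ yss) {x} (_ ∷ ne) sorted (suc i) x∈ with h F.≤? x
... | yes _ = cong suc (started-part (h ∷ hs) yss ne (AllPairs-⊆ (++⁺ˡ ys ⊆-refl) sorted) i x∈)
... | no h≰x = ⊥-elim (h≰x (h-least (AllPairs-⊆ (++⁺ˡ ys ⊆-refl) sorted) (in-concat ((h ∷ hs) ∷ yss) i x∈)))
  where
  in-concat : ∀ yss i {x} → x ∈ lookup yss i → x ∈ concat yss
  in-concat (ys ∷ yss) zero x∈ = ∈-++⁺ˡ x∈
  in-concat (ys ∷ yss) (suc i) x∈ = ∈-++⁺ʳ ys (in-concat yss i x∈)
  h-least : ∀ {h x zs} → AllPairs F._<_ (h ∷ zs) → x ∈ h ∷ zs → h F.≤ x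
  h-least _ (here refl) = ≤-refl
  h-least (h< ∷ _) (there x∈) = <⇒≤ (All.lookup h< x∈)

adjacency : ∀ {n} → Graph n → SymRel (Fin n)
adjacency G = record { rel = adj G ; symm = adj-sym G ; irrefl = adj-irrefl G }

Minor⇒ContainsK : ∀ {n} (G : Graph n) → Minor Anything (suc t) (adjacency G) [_] (allFin n) → ContainsK (suc t) G
Minor⇒ContainsK {n = n} G record { parts = ys ∷ yss ; count = refl ; within = sub ; marked = ne ; linked = links } =
  f , monotone , surjective , edges
  where
  f : Fin n → Fin (suc (length yss))
  -- As the first part is not counted, the vertices before it also fall into interval 0.
  f x = fromℕ< (s≤s (started-≤ yss x))
  toℕ-f : ∀ x → toℕ (f x) ≡ started yss x
  toℕ-f x = Finₚ.toℕ-fromℕ< (s≤s (started-≤ yss x))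
  f-part : ∀ i {x} → x ∈ lookup (ys ∷ yss) i → f x ≡ i
  f-part i x∈ = Finₚ.toℕ-injective (trans (toℕ-f _)
    (started-part ys yss (All.tail ne) (AllPairs-⊆ sub (AllPairsₚ.tabulate⁺-< id)) i x∈))
  monotone : ∀ x y → x F.≤ y → f x F.≤ f y
  monotone x y x≤y rewrite toℕ-f x | toℕ-f y = started-mono yss x≤y
  surjective : ∀ a → ∃ λ x → f x ≡ a
  surjective a = let x , x∈ , _ = find (All.lookup ne (∈-lookup a)) in x , f-part a x∈
  Edge : (a b : Fin (suc (length yss))) → Set
  Edge a b = ∃ λ x → ∃ λ y → f x ≡ a × f y ≡ b × adj G x y ≡ true
  forward : ∀ {a b} → a F.< b → Edge a b
  forward {a} {b} a<b =
    let x , y , x∈ , y∈ , xy = AllPairs-lookup links a<b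
    in x , y , f-part a (subst (x ∈_) (concatMap-pure _) x∈) , f-part b (subst (y ∈_) (concatMap-pure _) y∈) , xy
  edges : ∀ a b → adj (complete (suc (length yss))) a b ≡ true → Edge a b
  edges a b ab with a F.≟ b
  edges a b () | yes _
  ... | no a≢b with <-cmp (toℕ a) (toℕ b)
  ... | tri< a<b _ _ = forward a<b
  ... | tri≈ _ a≡b _ = ⊥-elim (a≢b (Finₚ.toℕ-injective a≡b))
  ... | tri> _ _ b<a = let x , y , fx , fy , xy = forward b<a in y , x , fy , fx , trans (adj-sym G y x) xy

-- The rank bound for ordered graphs

lookup-tabulate : ∀ {n} (f : Fin n → A) i → f (cast (length-tabulate f) i) ≡ lookup (tabulate f) i
lookup-tabulate {n = suc n} f zero = refl
lookup-tabulate {n = suc n} f (suc i) = lookup-tabulate (f ∘ suc) i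

theorem3 : (t : ℕ) → 1 ≤ t →
    ∃ λ r → ∀ (n : ℕ) (G : Graph n) → ¬ ContainsK t G → RankAtMost r G
theorem3 (suc t) _ with bounded t
... | r , rank-r = r , λ n G ¬K → r , ≤-refl ,
  cast-ext (Level-ext r) _ G (length-tabulate id)
    (λ i j → cong₂ (adj G) (lookup-tabulate id i) (lookup-tabulate id j))
    (level (subst (InLevel r (adjacency G)) (concatMap-pure (allFin n))
      -- Each vertex is a block of its own, so excluding minors made of blocks excludes all interval
      -- minors.
      (rank-r (adjacency G) [_] (allFin n) (λ x → noEdge λ { (here refl) (here refl) → adj-irrefl G x })
        (¬K ∘ Minor⇒ContainsK G))))
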